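{- Let $\epsilon = \epsilon(n)$ be such that $|\epsilon|^3 n \rightarrow \infty$ and $\epsilon = o(1)$, and let $p=\frac{1 + \epsilon}{n}$. (i) If $\epsilon < 0$, then with probability $1 - O\left(\left(|\epsilon|^3 n\right)^{ -1}\right)$, $G(n,n,p)$ contains no complex components. (ii) If $\epsilon > 0$, then with probability $1 - O\left(\left(\epsilon^3 n\right)^{ -1}\right)$, $G(n,n,p)$ contains no complex components of order at most $n^{\frac{2}{3}}$.
   Context: $G(n,n,p)$ is the binomial random bipartite graph with two partition classes, each of size $n$, in which each edge between the classes is included independently with probability $p$. A complex component is a component containing more than one cycle; the order of a component is its number of vertices. All asymptotics are as $n\to\infty$. -}

module Defs where

open import Data.Bool using (Bool; true; false; T; if_then_else_)
open import Data.Bool.Properties using (T?)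
open import Data.Fin as Fin using (Fin; zero; suc)
import Data.Fin.Properties as Fin
open import Data.Integer using (+_)
open import Data.List as List
  using (List; []; _∷_; _++_; _∷ʳ_; map; length; filter; zip; cartesianProductWith; allFin)
import Data.List.Membership.DecPropositional as MembershipDec
open import Data.List.Membership.Propositional using (_∈_; lose; find)
open import Data.List.Membership.Propositional.Properties
  using (∈-++⁺ˡ; ∈-++⁺ʳ; ∈-map⁺; ∈-allFin; ∈-cartesianProductWith⁺; ∈-lookup)
open import Data.List.Relation.Unary.All as All using (All; []; _∷_)
open import Data.List.Relation.Unary.AllPairs using ([]; _∷_)
open import Data.List.Relation.Unary.Any as Any using (Any; here; there)
import Data.List.Relation.Unary.Unique.DecPropositional as UniqueDec
open import Data.List.Relation.Unary.Unique.Propositional using (Unique)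
open import Data.Nat as ℕ using (ℕ; NonZero; z≤n; s≤s)
import Data.Nat.Properties as ℕ
open import Data.Product using (∃; _×_; _,_; proj₁; proj₂; uncurry)
import Data.Product.Properties as Product
open import Data.Rational as ℚ using (ℚ; 0ℚ; 1ℚ; ½)
import Data.Rational.Properties as ℚ
open import Data.Rational.Solver using (module +-*-Solver)
open import Data.Sum as Sum using (_⊎_; inj₁; inj₂; [_,_])
import Data.Sum.Properties as Sum
open import Data.Vec as Vec using (Vec; []; _∷_; lookup)
open import Function using (_∘_)
open import Relation.Binary.Construct.Closure.ReflexiveTransitive using (Star; _◅_; _◅◅_)
  renaming (ε to stay)
open import Relation.Binary.Definitions using (DecidableEquality)
open import Relation.Binary.PropositionalEquality
  using (_≡_; refl; sym; trans; cong; cong₂; subst)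
open import Relation.Nullary using (Dec; no; ¬_; contradiction)
open import Relation.Nullary.Decidable using (map′; _×-dec_; _⊎-dec_; _→-dec_; ¬?)
open import Relation.Unary using (Decidable)

------------------------------------------------------------------------
-- Real numbers

-- A real is a Cauchy sequence of rationals; two of them denote the same
-- real when each is ≤ the other.
record ℝ : Set where
  constructor mkℝ
  field
    approx : ℕ → ℚ
    cauchy : ∀ e → 0ℚ ℚ.< e →
             ∃ λ N → ∀ m n → N ℕ.≤ m → N ℕ.≤ n → ℚ.∣ approx m ℚ.- approx n ∣ ℚ.< e

open ℝ public

infix 4 _≤_ _<_
infixl 6 _+_ _-_
infixl 7 _*_
infix 8 -_
infixr 8 _^_

_≤_ : ℝ → ℝ → Set
x ≤ y = ∀ e → 0ℚ ℚ.< e →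
        ∃ λ N → ∀ m → N ℕ.≤ m → approx x m ℚ.≤ approx y m ℚ.+ e

_<_ : ℝ → ℝ → Set
x < y = ∃ λ e → 0ℚ ℚ.< e ×
        ∃ λ N → ∀ m → N ℕ.≤ m → approx x m ℚ.+ e ℚ.≤ approx y m

fromℚ : ℚ → ℝ
fromℚ q = mkℝ (λ _ → q) λ e 0<e → 0 , λ _ _ _ _ →
  subst (ℚ._< e) (sym (cong ℚ.∣_∣ (ℚ.+-inverseʳ q))) 0<e

fromℕ : ℕ → ℝ
fromℕ n = fromℚ (+ n ℚ./ 1)

0ᴿ 1ᴿ : ℝ
0ᴿ = fromℚ 0ℚ
1ᴿ = fromℚ 1ℚ

half-pos : ∀ e → 0ℚ ℚ.< e → 0ℚ ℚ.< e ℚ.* ½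
half-pos e 0<e = ℚ.positive⁻¹ (e ℚ.* ½) {{ℚ.pos*pos⇒pos e {{ℚ.positive 0<e}} ½}}

halves : ∀ e → e ℚ.* ½ ℚ.+ e ℚ.* ½ ≡ e
halves e = trans (sym (ℚ.*-distribˡ-+ e ½ ½)) (ℚ.*-identityʳ e)

∣∣-reverse : ∀ a b → ℚ.∣ ℚ.∣ a ∣ ℚ.- ℚ.∣ b ∣ ∣ ℚ.≤ ℚ.∣ a ℚ.- b ∣
∣∣-reverse a b with ℚ.∣p∣≡p∨∣p∣≡-p (ℚ.∣ a ∣ ℚ.- ℚ.∣ b ∣)
... | inj₁ eq = subst (ℚ._≤ ℚ.∣ a ℚ.- b ∣) (sym eq) (one-sided a b)
  where
  one-sided : ∀ x y → ℚ.∣ x ∣ ℚ.- ℚ.∣ y ∣ ℚ.≤ ℚ.∣ x ℚ.- y ∣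
  one-sided x y = begin
    ℚ.∣ x ∣ ℚ.- ℚ.∣ y ∣
      ≡⟨ cong (λ z → ℚ.∣ z ∣ ℚ.- ℚ.∣ y ∣) (solve 2 (λ x y → x := (x :- y) :+ y) refl x y) ⟩
    ℚ.∣ (x ℚ.- y) ℚ.+ y ∣ ℚ.- ℚ.∣ y ∣
      ≤⟨ ℚ.+-monoˡ-≤ (ℚ.- ℚ.∣ y ∣) (ℚ.∣p+q∣≤∣p∣+∣q∣ (x ℚ.- y) y) ⟩
    ℚ.∣ x ℚ.- y ∣ ℚ.+ ℚ.∣ y ∣ ℚ.- ℚ.∣ y ∣
      ≡⟨ solve 2 (λ u v → (u :+ v) :- v := u) refl ℚ.∣ x ℚ.- y ∣ ℚ.∣ y ∣ ⟩
    ℚ.∣ x ℚ.- y ∣ ∎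
    where
    open ℚ.≤-Reasoning
    open +-*-Solver
... | inj₂ eq = begin
    ℚ.∣ ℚ.∣ a ∣ ℚ.- ℚ.∣ b ∣ ∣  ≡⟨ eq ⟩
    ℚ.- (ℚ.∣ a ∣ ℚ.- ℚ.∣ b ∣)
      ≡⟨ solve 2 (λ u v → :- (u :- v) := v :- u) refl ℚ.∣ a ∣ ℚ.∣ b ∣ ⟩
    ℚ.∣ b ∣ ℚ.- ℚ.∣ a ∣
      ≡⟨ cong (λ z → ℚ.∣ z ∣ ℚ.- ℚ.∣ a ∣) (solve 2 (λ x y → y := (y :- x) :+ x) refl a b) ⟩
    ℚ.∣ (b ℚ.- a) ℚ.+ a ∣ ℚ.- ℚ.∣ a ∣
      ≤⟨ ℚ.+-monoˡ-≤ (ℚ.- ℚ.∣ a ∣) (ℚ.∣p+q∣≤∣p∣+∣q∣ (b ℚ.- a) a) ⟩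
    ℚ.∣ b ℚ.- a ∣ ℚ.+ ℚ.∣ a ∣ ℚ.- ℚ.∣ a ∣
      ≡⟨ solve 2 (λ u v → (u :+ v) :- v := u) refl ℚ.∣ b ℚ.- a ∣ ℚ.∣ a ∣ ⟩
    ℚ.∣ b ℚ.- a ∣          ≡⟨ sym (ℚ.∣-p∣≡∣p∣ (b ℚ.- a)) ⟩
    ℚ.∣ ℚ.- (b ℚ.- a) ∣
      ≡⟨ cong ℚ.∣_∣ (solve 2 (λ x y → :- (y :- x) := x :- y) refl a b) ⟩
    ℚ.∣ a ℚ.- b ∣ ∎
    where
    open ℚ.≤-Reasoning
    open +-*-Solver

eventuallyBounded : ∀ x → ∃ λ B → 0ℚ ℚ.< B ×
  ∃ λ N → ∀ m → N ℕ.≤ m → ℚ.∣ approx x m ∣ ℚ.≤ B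
eventuallyBounded x with cauchy x 1ℚ (ℚ.positive⁻¹ 1ℚ)
... | N , close = ℚ.∣ c ∣ ℚ.+ 1ℚ
                , ℚ.+-mono-≤-< (ℚ.0≤∣p∣ c) (ℚ.positive⁻¹ 1ℚ)
                , N , bound
  where
  open +-*-Solver
  c = approx x N
  bound : ∀ m → N ℕ.≤ m → ℚ.∣ approx x m ∣ ℚ.≤ ℚ.∣ c ∣ ℚ.+ 1ℚ
  bound m N≤m = begin
    ℚ.∣ a ∣                       ≡⟨ cong ℚ.∣_∣ (solve 2 (λ a c → a := c :+ (a :- c)) refl a c) ⟩
    ℚ.∣ c ℚ.+ (a ℚ.- c) ∣         ≤⟨ ℚ.∣p+q∣≤∣p∣+∣q∣ c (a ℚ.- c) ⟩
    ℚ.∣ c ∣ ℚ.+ ℚ.∣ a ℚ.- c ∣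
      ≤⟨ ℚ.+-monoʳ-≤ ℚ.∣ c ∣ (ℚ.<⇒≤ (close m N N≤m ℕ.≤-refl)) ⟩
    ℚ.∣ c ∣ ℚ.+ 1ℚ                ∎
    where
    open ℚ.≤-Reasoning
    a = approx x m

_+_ : ℝ → ℝ → ℝ
x + y = mkℝ (λ n → approx x n ℚ.+ approx y n) proof
  where
  proof : ∀ e → 0ℚ ℚ.< e → ∃ λ N → ∀ m n → N ℕ.≤ m → N ℕ.≤ n →
          ℚ.∣ (approx x m ℚ.+ approx y m) ℚ.- (approx x n ℚ.+ approx y n) ∣ ℚ.< e
  proof e 0<e with cauchy x (e ℚ.* ½) (half-pos e 0<e) | cauchy y (e ℚ.* ½) (half-pos e 0<e)
  ... | N₁ , close₁ | N₂ , close₂ = N₁ ℕ.⊔ N₂ , λ m n N≤m N≤n →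
    let a = approx x m; a′ = approx x n; b = approx y m; b′ = approx y n in begin-strict
      ℚ.∣ (a ℚ.+ b) ℚ.- (a′ ℚ.+ b′) ∣
        ≡⟨ cong ℚ.∣_∣ (solve 4 (λ a a′ b b′ → (a :+ b) :- (a′ :+ b′) := (a :- a′) :+ (b :- b′))
                         refl a a′ b b′) ⟩
      ℚ.∣ (a ℚ.- a′) ℚ.+ (b ℚ.- b′) ∣
        ≤⟨ ℚ.∣p+q∣≤∣p∣+∣q∣ (a ℚ.- a′) (b ℚ.- b′) ⟩
      ℚ.∣ a ℚ.- a′ ∣ ℚ.+ ℚ.∣ b ℚ.- b′ ∣
        <⟨ ℚ.+-mono-< (close₁ m n (ℕ.m⊔n≤o⇒m≤o N₁ N₂ N≤m) (ℕ.m⊔n≤o⇒m≤o N₁ N₂ N≤n))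
                      (close₂ m n (ℕ.m⊔n≤o⇒n≤o N₁ N₂ N≤m) (ℕ.m⊔n≤o⇒n≤o N₁ N₂ N≤n)) ⟩
      e ℚ.* ½ ℚ.+ e ℚ.* ½ ≡⟨ halves e ⟩
      e ∎
    where
    open ℚ.≤-Reasoning
    open +-*-Solver

-_ : ℝ → ℝ
- x = mkℝ (λ n → ℚ.- approx x n) λ e 0<e →
  let N , close = cauchy x e 0<e in N , λ m n N≤m N≤n →
    subst (ℚ._< e)
      (trans (sym (ℚ.∣-p∣≡∣p∣ (approx x m ℚ.- approx x n)))
             (cong ℚ.∣_∣ (ℚ.neg-distrib-+ (approx x m) (ℚ.- approx x n))))
      (close m n N≤m N≤n)

_-_ : ℝ → ℝ → ℝ
x - y = x + - y

∣_∣ : ℝ → ℝ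
∣ x ∣ = mkℝ (λ n → ℚ.∣ approx x n ∣) λ e 0<e →
  let N , close = cauchy x e 0<e in N , λ m n N≤m N≤n →
    ℚ.≤-<-trans (∣∣-reverse (approx x m) (approx x n)) (close m n N≤m N≤n)

product-close : ∀ {B C δ} a a′ b b′ → 0ℚ ℚ.< B → 0ℚ ℚ.< C →
  ℚ.∣ a ∣ ℚ.≤ B → ℚ.∣ b′ ∣ ℚ.≤ C →
  ℚ.∣ a ℚ.- a′ ∣ ℚ.< δ → ℚ.∣ b ℚ.- b′ ∣ ℚ.< δ →
  ℚ.∣ a ℚ.* b ℚ.- a′ ℚ.* b′ ∣ ℚ.< (B ℚ.+ C) ℚ.* δ
product-close {B} {C} {δ} a a′ b b′ 0<B 0<C a≤B b′≤C a-close b-close = begin-strict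
  ℚ.∣ a ℚ.* b ℚ.- a′ ℚ.* b′ ∣
    ≡⟨ cong ℚ.∣_∣ (solve 4 (λ a a′ b b′ → a :* b :- a′ :* b′ := a :* (b :- b′) :+ b′ :* (a :- a′))
                     refl a a′ b b′) ⟩
  ℚ.∣ a ℚ.* (b ℚ.- b′) ℚ.+ b′ ℚ.* (a ℚ.- a′) ∣
    ≤⟨ ℚ.∣p+q∣≤∣p∣+∣q∣ (a ℚ.* (b ℚ.- b′)) (b′ ℚ.* (a ℚ.- a′)) ⟩
  ℚ.∣ a ℚ.* (b ℚ.- b′) ∣ ℚ.+ ℚ.∣ b′ ℚ.* (a ℚ.- a′) ∣
    <⟨ ℚ.+-mono-< (bound a (b ℚ.- b′) 0<B a≤B b-close) (bound b′ (a ℚ.- a′) 0<C b′≤C a-close) ⟩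
  B ℚ.* δ ℚ.+ C ℚ.* δ
    ≡⟨ sym (ℚ.*-distribʳ-+ δ B C) ⟩
  (B ℚ.+ C) ℚ.* δ ∎
  where
  open ℚ.≤-Reasoning
  open +-*-Solver
  bound : ∀ {D} u v → 0ℚ ℚ.< D → ℚ.∣ u ∣ ℚ.≤ D → ℚ.∣ v ∣ ℚ.< δ → ℚ.∣ u ℚ.* v ∣ ℚ.< D ℚ.* δ
  bound {D} u v 0<D u≤D v<δ = subst (ℚ._< D ℚ.* δ) (sym (ℚ.∣p*q∣≡∣p∣*∣q∣ u v))
    (ℚ.≤-<-trans
      (ℚ.*-monoʳ-≤-nonNeg ℚ.∣ v ∣ {{ℚ.∣-∣-nonNeg v}} u≤D)
      (ℚ.*-monoʳ-<-pos D {{ℚ.positive 0<D}} v<δ))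

quotient : ∀ S e → 0ℚ ℚ.< S → 0ℚ ℚ.< e → ∃ λ δ → 0ℚ ℚ.< δ × S ℚ.* δ ≡ e
quotient S e 0<S 0<e =
    r ℚ.* e
  , ℚ.positive⁻¹ (r ℚ.* e) {{ℚ.pos*pos⇒pos r {{ℚ.1/pos⇒pos S}} e {{ℚ.positive 0<e}}}}
  , trans (sym (ℚ.*-assoc S r e)) (trans (cong (ℚ._* e) (ℚ.*-inverseʳ S)) (ℚ.*-identityˡ e))
  where
  instance
    posS : ℚ.Positive S
    posS = ℚ.positive 0<S
    nzS : ℚ.NonZero S
    nzS = ℚ.pos⇒nonZero S
  r = ℚ.1/ S

_*_ : ℝ → ℝ → ℝ
x * y = mkℝ (λ n → approx x n ℚ.* approx y n) λ e 0<e →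
  let B , 0<B , M₁ , bound₁ = eventuallyBounded x
      C , 0<C , M₂ , bound₂ = eventuallyBounded y
      δ , 0<δ , eq = quotient (B ℚ.+ C) e (ℚ.+-mono-< 0<B 0<C) 0<e
      N₁ , close₁ = cauchy x δ 0<δ
      N₂ , close₂ = cauchy y δ 0<δ
      M = M₁ ℕ.⊔ M₂
      N = N₁ ℕ.⊔ N₂
  in M ℕ.⊔ N , λ m n ≤m ≤n →
    subst (ℚ.∣ approx x m ℚ.* approx y m ℚ.- approx x n ℚ.* approx y n ∣ ℚ.<_) eq
      (product-close (approx x m) (approx x n) (approx y m) (approx y n) 0<B 0<C
        (bound₁ m (ℕ.m⊔n≤o⇒m≤o M₁ M₂ (ℕ.m⊔n≤o⇒m≤o M N ≤m)))
        (bound₂ n (ℕ.m⊔n≤o⇒n≤o M₁ M₂ (ℕ.m⊔n≤o⇒m≤o M N ≤n)))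
        (close₁ m n (ℕ.m⊔n≤o⇒m≤o N₁ N₂ (ℕ.m⊔n≤o⇒n≤o M N ≤m)) (ℕ.m⊔n≤o⇒m≤o N₁ N₂ (ℕ.m⊔n≤o⇒n≤o M N ≤n)))
        (close₂ m n (ℕ.m⊔n≤o⇒n≤o N₁ N₂ (ℕ.m⊔n≤o⇒n≤o M N ≤m)) (ℕ.m⊔n≤o⇒n≤o N₁ N₂ (ℕ.m⊔n≤o⇒n≤o M N ≤n))))

_^_ : ℝ → ℕ → ℝ
x ^ 0       = 1ᴿ
x ^ ℕ.suc k = x * x ^ k

∑ ∏ : List ℝ → ℝ
∑ = List.foldr _+_ 0ᴿ
∏ = List.foldr _*_ 1ᴿ

------------------------------------------------------------------------
-- Asymptotics

Sequence : Set
Sequence = (n : ℕ) .{{_ : NonZero n}} → ℝ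

infix 3 _⟶∞ _=o[1] _=O[1/_]

_⟶∞ : Sequence → Set
f ⟶∞ = ∀ (M : ℝ) → ∃ λ N → ∀ n .{{_ : NonZero n}} → N ℕ.≤ n → M ≤ f n

_=o[1] : Sequence → Set
f =o[1] = ∀ (δ : ℝ) → 0ᴿ < δ → ∃ λ N → ∀ n .{{_ : NonZero n}} → N ℕ.≤ n → ∣ f n ∣ ≤ δ

-- f = O(h⁻¹) for a (eventually) positive sequence h: the defining inequality
-- |f n| ≤ C (h n)⁻¹ is written as |f n| h n ≤ C.
_=O[1/_] : Sequence → Sequence → Set
f =O[1/ h ] = ∃ λ (C : ℝ) → ∃ λ N → ∀ n .{{_ : NonZero n}} → N ℕ.≤ n → ∣ f n ∣ * h n ≤ C

------------------------------------------------------------------------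
-- Bipartite graphs with two classes of size n

-- Row i, column j records whether vertex i of the first class is joined to
-- vertex j of the second.
BipGraph : ℕ → Set
BipGraph n = Vec (Vec Bool n) n

edge : ∀ {n} → BipGraph n → Fin n → Fin n → Bool
edge G i j = lookup (lookup G i) j

Vertex : ℕ → Set
Vertex n = Fin n ⊎ Fin n

data Adj {n} (G : BipGraph n) : Vertex n → Vertex n → Set where
  left-right : ∀ {i j} → T (edge G i j) → Adj G (inj₁ i) (inj₂ j)
  right-left : ∀ {i j} → T (edge G i j) → Adj G (inj₂ j) (inj₁ i)

Connected : ∀ {n} → BipGraph n → Vertex n → Vertex n → Set
Connected G = Star (Adj G)

-- The cyclically consecutive pairs of a list of vertices.
steps : ∀ {n} → List (Vertex n) → List (Vertex n × Vertex n)
steps []       = []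
steps (v ∷ vs) = zip (v ∷ vs) (vs ∷ʳ v)

IsCycle : ∀ {n} → BipGraph n → List (Vertex n) → Set
IsCycle G c = 3 ℕ.≤ length c × Unique c × All (uncurry (Adj G)) (steps c)

_EdgeOf_ : ∀ {n} → Vertex n × Vertex n → List (Vertex n) → Set
(u , w) EdgeOf c = (u , w) ∈ steps c ⊎ (w , u) ∈ steps c

-- Vertex lists that differ by rotation or reversal describe the same cycle,
-- so cycles are compared through their sets of undirected edges.
SameCycle : ∀ {n} → List (Vertex n) → List (Vertex n) → Set
SameCycle c d = All (_EdgeOf d) (steps c) × All (_EdgeOf c) (steps d)

-- A component is represented by any one of its vertices v.
CycleInComponent : ∀ {n} → BipGraph n → Vertex n → List (Vertex n) → Set
CycleInComponent G v c = IsCycle G c × All (Connected G v) c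

ComplexComponent : ∀ {n} → BipGraph n → Vertex n → Set
ComplexComponent G v =
  ∃ λ c → CycleInComponent G v c × ∃ λ d → CycleInComponent G v d × ¬ SameCycle c d

vertices : ∀ n → List (Vertex n)
vertices n = map inj₁ (allFin n) ++ map inj₂ (allFin n)

∈-vertices : ∀ {n} (v : Vertex n) → v ∈ vertices n
∈-vertices (inj₁ i) = ∈-++⁺ˡ (∈-map⁺ inj₁ (∈-allFin i))
∈-vertices {n} (inj₂ j) = ∈-++⁺ʳ (map inj₁ (allFin n)) (∈-map⁺ inj₂ (∈-allFin j))

_≟ⱽ_ : ∀ {n} → DecidableEquality (Vertex n)
_≟ⱽ_ = Sum.≡-dec Fin._≟_ Fin._≟_

adj? : ∀ {n} (G : BipGraph n) u v → Dec (Adj G u v)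
adj? G (inj₁ i) (inj₂ j) = map′ left-right (λ { (left-right e) → e }) (T? (edge G i j))
adj? G (inj₂ j) (inj₁ i) = map′ right-left (λ { (right-left e) → e }) (T? (edge G i j))
adj? G (inj₁ _) (inj₁ _) = no λ ()
adj? G (inj₂ _) (inj₂ _) = no λ ()

-- Walks whose interior vertices lie in the given list (Warshall's algorithm).
Via : ∀ {n} → BipGraph n → List (Vertex n) → Vertex n → Vertex n → Set
Via G []       u v = u ≡ v ⊎ Adj G u v
Via G (x ∷ xs) u v = Via G xs u v ⊎ (Via G xs u x × Via G xs x v)

via? : ∀ {n} (G : BipGraph n) xs u v → Dec (Via G xs u v)
via? G []       u v = (u ≟ⱽ v) ⊎-dec adj? G u v
via? G (x ∷ xs) u v = via? G xs u v ⊎-dec (via? G xs u x ×-dec via? G xs x v)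

via-base : ∀ {n} (G : BipGraph n) xs {u v} → u ≡ v ⊎ Adj G u v → Via G xs u v
via-base G []       b = b
via-base G (x ∷ xs) b = inj₁ (via-base G xs b)

via-sound : ∀ {n} (G : BipGraph n) xs {u v} → Via G xs u v → Connected G u v
via-sound G []       (inj₁ refl)    = stay
via-sound G []       (inj₂ a)       = a ◅ stay
via-sound G (x ∷ xs) (inj₁ w)       = via-sound G xs w
via-sound G (x ∷ xs) (inj₂ (w , z)) = via-sound G xs w ◅◅ via-sound G xs z

via-trans : ∀ {n} (G : BipGraph n) {x} xs {u v} → x ∈ xs →
            Via G xs u x → Via G xs x v → Via G xs u v
via-trans G (y ∷ ys) (here refl) p q =
  inj₂ ([ (λ z → z) , proj₁ ] p , [ (λ z → z) , proj₂ ] q)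
via-trans G (y ∷ ys) (there x∈) (inj₁ p)       (inj₁ q)       = inj₁ (via-trans G ys x∈ p q)
via-trans G (y ∷ ys) (there x∈) (inj₁ p)       (inj₂ (q , r)) = inj₂ (via-trans G ys x∈ p q , r)
via-trans G (y ∷ ys) (there x∈) (inj₂ (o , p)) (inj₁ q)       = inj₂ (o , via-trans G ys x∈ p q)
via-trans G (y ∷ ys) (there x∈) (inj₂ (o , p)) (inj₂ (q , r)) = inj₂ (o , r)

via-complete : ∀ {n} (G : BipGraph n) {u v} → Connected G u v → Via G (vertices n) u v
via-complete {n} G stay = via-base G (vertices n) (inj₁ refl)
via-complete {n} G (_◅_ {j = w} a p) =
  via-trans G (vertices n) (∈-vertices w)
    (via-base G (vertices n) (inj₂ a)) (via-complete G p)

connected? : ∀ {n} (G : BipGraph n) u v → Dec (Connected G u v)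
connected? {n} G u v = map′ (via-sound G (vertices n)) (via-complete G) (via? G (vertices n) u v)

order : ∀ {n} → BipGraph n → Vertex n → ℕ
order {n} G v = length (filter (connected? G v) (vertices n))

NoComplexComponent : ∀ {n} → BipGraph n → Set
NoComplexComponent G = ∀ v → ¬ ComplexComponent G v

-- For a natural number k, k ≤ n^(2/3) means k³ ≤ n².
NoSmallComplexComponent : ∀ {n} → BipGraph n → Set
NoSmallComplexComponent {n} G =
  ∀ v → order G v ℕ.^ 3 ℕ.≤ n ℕ.^ 2 → ¬ ComplexComponent G v

allVertices? : ∀ {n} {P : Vertex n → Set} → Decidable P → Dec (∀ v → P v)
allVertices? P? = map′ (uncurry [_,_]) (λ f → f ∘ inj₁ , f ∘ inj₂)
  (Fin.all? (P? ∘ inj₁) ×-dec Fin.all? (P? ∘ inj₂))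

listsOfLength≤ : ∀ n → ℕ → List (List (Vertex n))
listsOfLength≤ n ℕ.zero    = [] ∷ []
listsOfLength≤ n (ℕ.suc k) = [] ∷ cartesianProductWith _∷_ (vertices n) (listsOfLength≤ n k)

∈-listsOfLength≤ : ∀ {n} k (xs : List (Vertex n)) → length xs ℕ.≤ k → xs ∈ listsOfLength≤ n k
∈-listsOfLength≤ ℕ.zero    []       _         = here refl
∈-listsOfLength≤ (ℕ.suc k) []       _         = here refl
∈-listsOfLength≤ (ℕ.suc k) (x ∷ xs) (s≤s len) =
  there (∈-cartesianProductWith⁺ _∷_ (∈-vertices x) (∈-listsOfLength≤ k xs len))

lookup-injective : ∀ {A : Set} {xs : List A} → Unique xs →
  ∀ i j → List.lookup xs i ≡ List.lookup xs j → i ≡ j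
lookup-injective (_  ∷ _) zero    zero    _  = refl
lookup-injective (x∉ ∷ _) zero    (suc j) eq = contradiction eq (All.lookup x∉ (∈-lookup j))
lookup-injective (x∉ ∷ _) (suc i) zero    eq = contradiction (sym eq) (All.lookup x∉ (∈-lookup i))
lookup-injective (_  ∷ u) (suc i) (suc j) eq = cong suc (lookup-injective u i j eq)

unique⇒length≤ : ∀ {n} {xs : List (Vertex n)} → Unique xs → length xs ℕ.≤ n ℕ.+ n
unique⇒length≤ {n} {xs} uniq = Fin.injective⇒≤ {f = Fin.join n n ∘ List.lookup xs} λ {i} {j} eq →
  lookup-injective uniq i j
    (trans (sym (Fin.splitAt-join n n (List.lookup xs i)))
      (trans (cong (Fin.splitAt n) eq) (Fin.splitAt-join n n (List.lookup xs j))))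

anyUniqueList? : ∀ {n} {P : List (Vertex n) → Set} → (∀ {xs} → P xs → Unique xs) →
  Decidable P → Dec (∃ P)
anyUniqueList? {n} uniq P? = map′
  (λ a → let xs , _ , p = find a in xs , p)
  (λ { (xs , p) → lose (∈-listsOfLength≤ (n ℕ.+ n) xs (unique⇒length≤ (uniq p))) p })
  (Any.any? P? (listsOfLength≤ n (n ℕ.+ n)))

unique? : ∀ {n} (xs : List (Vertex n)) → Dec (Unique xs)
unique? = UniqueDec.unique? _≟ⱽ_

isCycle? : ∀ {n} (G : BipGraph n) → Decidable (IsCycle G)
isCycle? G c = (3 ℕ.≤? length c) ×-dec (unique? c ×-dec All.all? (uncurry (adj? G)) (steps c))

edgeOf? : ∀ {n} (c : List (Vertex n)) → Decidable (_EdgeOf c)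
edgeOf? c (u , w) = ((u , w) ∈? steps c) ⊎-dec ((w , u) ∈? steps c)
  where _∈?_ = MembershipDec._∈?_ (Product.≡-dec _≟ⱽ_ _≟ⱽ_)

sameCycle? : ∀ {n} (c d : List (Vertex n)) → Dec (SameCycle c d)
sameCycle? c d = All.all? (edgeOf? d) (steps c) ×-dec All.all? (edgeOf? c) (steps d)

cycleInComponent? : ∀ {n} (G : BipGraph n) v → Decidable (CycleInComponent G v)
cycleInComponent? G v c = isCycle? G c ×-dec All.all? (connected? G v) c

complexComponent? : ∀ {n} (G : BipGraph n) → Decidable (ComplexComponent G)
complexComponent? G v =
  anyUniqueList? (λ (((_ , uniq , _) , _) , _) → uniq) λ c →
    cycleInComponent? G v c ×-dec
    anyUniqueList? (λ (((_ , uniq , _) , _) , _) → uniq) λ d →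
      cycleInComponent? G v d ×-dec ¬? (sameCycle? c d)

noComplexComponent? : ∀ {n} → Decidable (NoComplexComponent {n})
noComplexComponent? G = allVertices? λ v → ¬? (complexComponent? G v)

noSmallComplexComponent? : ∀ {n} → Decidable (NoSmallComplexComponent {n})
noSmallComplexComponent? {n} G = allVertices? λ v →
  (order G v ℕ.^ 3 ℕ.≤? n ℕ.^ 2) →-dec ¬? (complexComponent? G v)

------------------------------------------------------------------------
-- The random graph G(n,n,p)

allVecs : ∀ {A : Set} → List A → ∀ n → List (Vec A n)
allVecs xs ℕ.zero    = [] ∷ []
allVecs xs (ℕ.suc n) = cartesianProductWith _∷_ xs (allVecs xs n)

allGraphs : ∀ n → List (BipGraph n)
allGraphs n = allVecs (allVecs (true ∷ false ∷ []) n) n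

-- The probability that G(n,n,p) equals G.
weight : ∀ {n} → ℝ → BipGraph n → ℝ
weight {n} p G =
  ∏ (map (λ i → ∏ (map (λ j → if edge G i j then p else 1ᴿ - p) (allFin n))) (allFin n))

-- The probability that G(n,n,p) has property A.
Pr : ∀ n → ℝ → (A : BipGraph n → Set) → Decidable A → ℝ
Pr n p A A? = ∑ (map (weight p) (filter A? (allGraphs n)))

edgeProbability : Sequence → Sequence
edgeProbability ε n = (1ᴿ + ε n) * fromℚ (+ 1 ℚ./ n)

{-# OPTIONS --safe #-}

-- A complex component contains a path with one further edge at each of its
-- ends leading back to the path; on k vertices there are at most 2 k² nᵏ such
-- subgraphs, each present with probability pᵏ⁺¹.  If moreover the component is
-- to be small, explore it from the k vertices of the path: while at most
-- n ^ (2/3) vertices have been found, the number of active vertices A behaves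
-- like a random walk with drift about ε, so that θ ^ A is a supermartingale
-- for θ = 1 - 5 ε / 4, and the exploration dies out with probability at most
-- θᵏ.  With θ = 1 in the subcritical case, the expected number of these
-- subgraphs is at most 2 p Σ k² ρᵏ ≤ 4 p (1 - ρ)⁻³, where ρ = n p θ is at most
-- 1 - |ε| / 4.  All this happens over ℚ: the probabilities are polynomials in
-- p, so the bounds hold for the rational approximations of ε.

module Submission where

open import Defs
open import Algebra.Bundles using (CommutativeRing)
open import Data.Bool using (Bool; true; false; T; not; if_then_else_)
open import Data.Fin as Fin using (Fin; zero; suc)
import Data.Fin.Properties as Fin
open import Data.Integer as ℤ using (+_)
import Data.Integer.Properties as ℤ
open import Data.List as List
  using (List; []; _∷_; _++_; _∷ʳ_; map; length; filter; zip; cartesianProductWith; allFin)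
import Data.List.Membership.DecPropositional as MembershipDec
open import Data.List.Membership.Propositional using (_∈_; _∉_; lose; find)
open import Data.List.Membership.Propositional.Properties
  using (∈-++⁺ˡ; ∈-++⁺ʳ; ∈-++⁻; ∈-∃++; ∈-map⁺; ∈-map⁻; ∈-allFin; ∈-downFrom⁺;
         ∈-cartesianProductWith⁺; ∈-cartesianProductWith⁻)
import Data.List.Properties as List
open import Data.List.Relation.Binary.Permutation.Propositional
  using (_↭_; ↭-sym; ↭-trans; ↭-refl; ↭-reflexive; ↭⇒↭ₛ; prep)
import Data.List.Relation.Binary.Permutation.Propositional.Properties as ↭
open import Data.List.Relation.Binary.Permutation.Setoid.Properties using (Unique-resp-↭)
open import Data.List.Relation.Unary.All as All using (All; []; _∷_)
import Data.List.Relation.Unary.All.Properties as All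
open import Data.List.Relation.Unary.AllPairs as AllPairs using (AllPairs; []; _∷_)
open import Data.List.Relation.Unary.Any as Any using (here; there)
open import Data.List.Relation.Unary.Unique.Propositional using (Unique)
import Data.List.Relation.Unary.Unique.Propositional.Properties as Unique
open import Data.Nat as ℕ using (ℕ; NonZero; z≤n; s≤s)
import Data.Nat.Properties as ℕ
open import Data.Product using (∃; _×_; _,_; proj₁; proj₂; uncurry)
open import Data.Rational as ℚ using (ℚ; 0ℚ; 1ℚ)
import Data.Rational.Properties as ℚ
open import Data.Rational.Solver using (module +-*-Solver)
import Data.Rational.Unnormalised as ℚᵘ
import Data.Rational.Unnormalised.Properties as ℚᵘ
open import Data.Sum using (_⊎_; inj₁; inj₂)
import Data.Sum.Properties as Sum
open import Data.Unit using (⊤; tt)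
open import Data.Vec as Vec using (Vec; []; _∷_; lookup)
import Data.Vec.Properties as Vec
open import Function using (_∘_; id; const)
open import Relation.Binary.Construct.Closure.ReflexiveTransitive as Star using (_◅_; _◅◅_)
  renaming (ε to stay)
open import Relation.Binary.PropositionalEquality
  using (_≡_; _≢_; refl; sym; trans; cong; cong₂; subst; subst₂; setoid; module ≡-Reasoning)
open import Relation.Nullary using (Dec; yes; no; does; ¬_; contradiction)
open import Relation.Nullary.Decidable using (_×-dec_; ¬?)
open import Relation.Unary using (Decidable)
open import Algebra.Properties.CommutativeSemiring.Exp
  (CommutativeRing.commutativeSemiring ℚ.+-*-commutativeRing)
  using (^-distrib-*) renaming (_^_ to _^ℚ_)
open +-*-Solver

-- For ε > 0 the bare first moment fails: Σ k² (n p)ᵏ has ratio 1 + ε, and k runs up to 2 n. The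
-- survival factor θᵏ must bring the ratio below 1, so θ = 1 - c ε needs c > 1 to first order. On
-- the other side c ε must stay below the survival probability of a nearly critical branching
-- process, which is about twice its drift. Once ε³ n ≥ 1000, having found n ^ (2/3) vertices costs
-- about a tenth of ε, and 3 ε / 4 of the drift remains, whence c < 3/2. The value 5/4 is the
-- midpoint, and writing ε = 4 t makes the coefficients integers. Conditional probabilities are
-- avoided: revealed edges are overwritten by a map σ of graphs, and E (f ∘ σ) takes the place of
-- the conditional expectation. The exploration can therefore start with the edges of the path
-- already forced in.

-- Most polynomial inequalities below are proved by exhibiting their slack d, which leaves a ring
-- identity to the solver.
≤-from-difference : ∀ {a b} d → 0ℚ ℚ.≤ d → a ℚ.+ d ≡ b → a ℚ.≤ b
≤-from-difference {a} {b} d 0≤d eq = begin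
  a          ≡⟨ ℚ.+-identityʳ a ⟨
  a ℚ.+ 0ℚ   ≤⟨ ℚ.+-monoʳ-≤ a 0≤d ⟩
  a ℚ.+ d    ≡⟨ eq ⟩
  b          ∎
  where open ℚ.≤-Reasoning

0≤-difference : ∀ {a b} → a ℚ.≤ b → 0ℚ ℚ.≤ b ℚ.- a
0≤-difference {a} {b} a≤b = subst (ℚ._≤ b ℚ.- a) (ℚ.+-inverseʳ a) (ℚ.+-monoˡ-≤ (ℚ.- a) a≤b)

*-monoʳ-≤ : ∀ {a b} c → 0ℚ ℚ.≤ c → a ℚ.≤ b → c ℚ.* a ℚ.≤ c ℚ.* b
*-monoʳ-≤ c 0≤c = ℚ.*-monoˡ-≤-nonNeg c {{ℚ.nonNegative 0≤c}}

*-monoˡ-≤ : ∀ {a b} c → 0ℚ ℚ.≤ c → a ℚ.≤ b → a ℚ.* c ℚ.≤ b ℚ.* c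
*-monoˡ-≤ c 0≤c = ℚ.*-monoʳ-≤-nonNeg c {{ℚ.nonNegative 0≤c}}

*-mono-≤ : ∀ {a b c d} → 0ℚ ℚ.≤ a → 0ℚ ℚ.≤ d → a ℚ.≤ b → c ℚ.≤ d → a ℚ.* c ℚ.≤ b ℚ.* d
*-mono-≤ {a} {d = d} 0≤a 0≤d a≤b c≤d = ℚ.≤-trans (*-monoʳ-≤ a 0≤a c≤d) (*-monoˡ-≤ d 0≤d a≤b)

0≤+ : ∀ {a b} → 0ℚ ℚ.≤ a → 0ℚ ℚ.≤ b → 0ℚ ℚ.≤ a ℚ.+ b
0≤+ = ℚ.+-mono-≤

0≤* : ∀ {a b} → 0ℚ ℚ.≤ a → 0ℚ ℚ.≤ b → 0ℚ ℚ.≤ a ℚ.* b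
0≤* {a} {b} 0≤a 0≤b = subst (ℚ._≤ a ℚ.* b) (ℚ.*-zeroʳ a) (*-monoʳ-≤ a 0≤a 0≤b)

0≤^ : ∀ {a} k → 0ℚ ℚ.≤ a → 0ℚ ℚ.≤ a ^ℚ k
0≤^ ℕ.zero    0≤a = ℚ.nonNegative⁻¹ 1ℚ
0≤^ (ℕ.suc k) 0≤a = 0≤* 0≤a (0≤^ k 0≤a)

-- Sums over lists

sum : {A : Set} → (A → ℚ) → List A → ℚ
sum f = List.foldr (λ x s → f x ℚ.+ s) 0ℚ

module _ {A : Set} where

  sum-cong : ∀ {f g : A → ℚ} → (∀ x → f x ≡ g x) → ∀ xs → sum f xs ≡ sum g xs
  sum-cong f≗g []       = refl
  sum-cong f≗g (x ∷ xs) = cong₂ ℚ._+_ (f≗g x) (sum-cong f≗g xs)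

  sum-++ : ∀ (f : A → ℚ) xs ys → sum f (xs ++ ys) ≡ sum f xs ℚ.+ sum f ys
  sum-++ f []       ys = sym (ℚ.+-identityˡ _)
  sum-++ f (x ∷ xs) ys = trans (cong (f x ℚ.+_) (sum-++ f xs ys)) (sym (ℚ.+-assoc (f x) _ _))

  sum-* : ∀ c (f : A → ℚ) xs → sum (λ x → c ℚ.* f x) xs ≡ c ℚ.* sum f xs
  sum-* c f []       = sym (ℚ.*-zeroʳ c)
  sum-* c f (x ∷ xs) = trans (cong (c ℚ.* f x ℚ.+_) (sum-* c f xs)) (sym (ℚ.*-distribˡ-+ c (f x) _))

  sum-map : ∀ {B : Set} (f : A → ℚ) (g : B → A) xs → sum f (map g xs) ≡ sum (f ∘ g) xs
  sum-map f g []       = refl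
  sum-map f g (x ∷ xs) = cong (f (g x) ℚ.+_) (sum-map f g xs)

  sum-nonNeg : ∀ {f : A → ℚ} → (∀ x → 0ℚ ℚ.≤ f x) → ∀ xs → 0ℚ ℚ.≤ sum f xs
  sum-nonNeg 0≤f []       = ℚ.≤-refl
  sum-nonNeg 0≤f (x ∷ xs) = 0≤+ (0≤f x) (sum-nonNeg 0≤f xs)

  sum-mono : ∀ {f g : A → ℚ} xs → (∀ x → x ∈ xs → f x ℚ.≤ g x) → sum f xs ℚ.≤ sum g xs
  sum-mono []       f≤g = ℚ.≤-refl
  sum-mono (x ∷ xs) f≤g = ℚ.+-mono-≤ (f≤g x (here refl)) (sum-mono xs λ y y∈ → f≤g y (there y∈))

  term≤sum : ∀ {f : A → ℚ} → (∀ x → 0ℚ ℚ.≤ f x) → ∀ {x xs} → x ∈ xs → f x ℚ.≤ sum f xs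
  term≤sum {f} 0≤f {xs = x ∷ xs} (here refl) =
    ≤-from-difference (sum f xs) (sum-nonNeg 0≤f xs) refl
  term≤sum {f} 0≤f {xs = y ∷ xs} (there x∈) = ℚ.≤-trans (term≤sum 0≤f x∈)
    (≤-from-difference (f y) (0≤f y) (ℚ.+-comm _ (f y)))

sum-cartesianProductWith : ∀ {A B C : Set} (f : C → ℚ) (_·_ : A → B → C) xs ys →
  sum f (cartesianProductWith _·_ xs ys) ≡ sum (λ x → sum (λ y → f (x · y)) ys) xs
sum-cartesianProductWith f _·_ []       ys = refl
sum-cartesianProductWith f _·_ (x ∷ xs) ys =
  trans (sum-++ f (map (x ·_) ys) (cartesianProductWith _·_ xs ys))
    (cong₂ ℚ._+_ (sum-map f (x ·_) ys) (sum-cartesianProductWith f _·_ xs ys))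

-- Expectations

-- A measure is handled as a functional. Beyond these laws, the later arguments need only that
-- single edges can be redrawn; the list of all graphs is met only when `Pr` is evaluated.
record IsExpectation {A : Set} (μ : (A → ℚ) → ℚ) : Set where
  field
    mono   : ∀ {f g} → (∀ a → f a ℚ.≤ g a) → μ f ℚ.≤ μ g
    linear : ∀ c f d g → μ (λ a → c ℚ.* f a ℚ.+ d ℚ.* g a) ≡ c ℚ.* μ f ℚ.+ d ℚ.* μ g
    unit   : ∀ c → μ (const c) ≡ c

  μ-cong : ∀ {f g} → (∀ a → f a ≡ g a) → μ f ≡ μ g
  μ-cong f≗g = ℚ.≤-antisym (mono λ a → ℚ.≤-reflexive (f≗g a))
                           (mono λ a → ℚ.≤-reflexive (sym (f≗g a)))

  μ-+ : ∀ f g → μ (λ a → f a ℚ.+ g a) ≡ μ f ℚ.+ μ g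
  μ-+ f g = trans
    (μ-cong λ a → sym (cong₂ ℚ._+_ (ℚ.*-identityˡ (f a)) (ℚ.*-identityˡ (g a))))
    (trans (linear 1ℚ f 1ℚ g) (cong₂ ℚ._+_ (ℚ.*-identityˡ (μ f)) (ℚ.*-identityˡ (μ g))))

  μ-sum : ∀ {B : Set} (f : B → A → ℚ) xs → μ (λ a → sum (λ b → f b a) xs) ≡ sum (λ b → μ (f b)) xs
  μ-sum f []       = unit 0ℚ
  μ-sum f (x ∷ xs) = trans (μ-+ (f x) _) (cong (μ (f x) ℚ.+_) (μ-sum f xs))

bernoulli : ℚ → (Bool → ℚ) → ℚ
bernoulli p f = p ℚ.* f true ℚ.+ (1ℚ ℚ.- p) ℚ.* f false

iid : {A : Set} → ((A → ℚ) → ℚ) → ∀ n → (Vec A n → ℚ) → ℚ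
iid μ ℕ.zero    f = f []
iid μ (ℕ.suc n) f = μ λ x → iid μ n λ xs → f (x ∷ xs)

bernoulli-isExpectation : ∀ {p} → 0ℚ ℚ.≤ p → p ℚ.≤ 1ℚ → IsExpectation (bernoulli p)
bernoulli-isExpectation {p} 0≤p p≤1 = record
  { mono   = λ f≤g → ℚ.+-mono-≤ (*-monoʳ-≤ p 0≤p (f≤g true))
                                (*-monoʳ-≤ (1ℚ ℚ.- p) (0≤-difference p≤1) (f≤g false))
  ; linear = λ c f d g →
      solve 7 (λ p c d ft ff gt gf →
        p :* (c :* ft :+ d :* gt) :+ (con 1ℚ :- p) :* (c :* ff :+ d :* gf) :=
        c :* (p :* ft :+ (con 1ℚ :- p) :* ff) :+ d :* (p :* gt :+ (con 1ℚ :- p) :* gf))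
        refl p c d (f true) (f false) (g true) (g false)
  ; unit   = solve 2 (λ p c → p :* c :+ (con 1ℚ :- p) :* c := c) refl p
  }

iid-isExpectation : ∀ {A μ} → IsExpectation {A} μ → ∀ n → IsExpectation (iid μ n)
iid-isExpectation isE ℕ.zero = record
  { mono = λ f≤g → f≤g [] ; linear = λ _ _ _ _ → refl ; unit = λ _ → refl }
iid-isExpectation {μ = μ} isE (ℕ.suc n) = record
  { mono   = λ f≤g → E.mono λ x → Eⁿ.mono λ xs → f≤g (x ∷ xs)
  ; linear = λ c f d g → trans (E.μ-cong λ x → Eⁿ.linear c _ d _) (E.linear c _ d _)
  ; unit   = λ c → trans (E.μ-cong λ _ → Eⁿ.unit c) (E.unit c)
  }
  where
  module E = IsExpectation isE
  module Eⁿ = IsExpectation (iid-isExpectation isE n)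

-- μ is unchanged when one of its coordinates is redrawn: s and t overwrite
-- that coordinate with its two possible values.
Redraws : {A : Set} → ((A → ℚ) → ℚ) → ℚ → (A → A) → (A → A) → Set
Redraws μ p s t = ∀ f → μ f ≡ p ℚ.* μ (f ∘ s) ℚ.+ (1ℚ ℚ.- p) ℚ.* μ (f ∘ t)

bernoulli-redraws : ∀ p → Redraws (bernoulli p) p (const true) (const false)
bernoulli-redraws p f = solve 3
  (λ p t f → p :* t :+ (con 1ℚ :- p) :* f :=
    p :* (p :* t :+ (con 1ℚ :- p) :* t) :+ (con 1ℚ :- p) :* (p :* f :+ (con 1ℚ :- p) :* f))
  refl p (f true) (f false)

-- At the head coordinate this is the law of the outer μ itself; further down, the mixture passes
-- through the outer μ by linearity. It is applied to an entry of a row and then to the row.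
iid-redraws : ∀ {A μ} p (s t : A → A) → IsExpectation μ → Redraws μ p s t → ∀ {n} (i : Fin n) →
  Redraws (iid μ n) p (λ v → Vec.updateAt v i s) (λ v → Vec.updateAt v i t)
iid-redraws p s t isE R zero    f = R _
iid-redraws p s t isE R (suc i) f =
  trans (E.μ-cong λ x → iid-redraws p s t isE R i _) (E.linear p _ (1ℚ ℚ.- p) _)
  where module E = IsExpectation isE

-- The random graph

Gnp : ∀ n → ℚ → (BipGraph n → ℚ) → ℚ
Gnp n p = iid (iid (bernoulli p) n) n

setEdge : ∀ {n} → Fin n → Fin n → Bool → BipGraph n → BipGraph n
setEdge i j b G = Vec.updateAt G i λ row → Vec.updateAt row j (const b)

Gnp-isExpectation : ∀ n {p} → 0ℚ ℚ.≤ p → p ℚ.≤ 1ℚ → IsExpectation (Gnp n p)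
Gnp-isExpectation n 0≤p p≤1 =
  iid-isExpectation (iid-isExpectation (bernoulli-isExpectation 0≤p p≤1) n) n

Gnp-redraws : ∀ {n p} → 0ℚ ℚ.≤ p → p ℚ.≤ 1ℚ → ∀ i j →
  Redraws (Gnp n p) p (setEdge i j true) (setEdge i j false)
Gnp-redraws {n} {p} 0≤p p≤1 i j =
  iid-redraws p (set true) (set false) (iid-isExpectation isE n)
    (iid-redraws p (const true) (const false) isE (bernoulli-redraws p) j) i
  where
  isE = bernoulli-isExpectation 0≤p p≤1
  set : Bool → Vec Bool n → Vec Bool n
  set b row = Vec.updateAt row j (const b)

product : List ℚ → ℚ
product = List.foldr ℚ._*_ 1ℚ

productWeight : {A : Set} → (A → ℚ) → ∀ {n} → Vec A n → ℚ
productWeight w v = product (List.tabulate (w ∘ lookup v))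

-- Fubini: the weight of a vector is a product, so the sum factors coordinate by coordinate. It is
-- used for the entries of a row and again for the rows.
iid-sum : ∀ {A : Set} (w : A → ℚ) xs {μ} →
  (∀ f → sum (λ x → w x ℚ.* f x) xs ≡ μ f) → IsExpectation μ →
  ∀ n f → sum (λ v → productWeight w v ℚ.* f v) (allVecs xs n) ≡ iid μ n f
iid-sum w xs sum≡μ isE ℕ.zero f = trans (ℚ.+-identityʳ _) (ℚ.*-identityˡ (f []))
iid-sum w xs {μ} sum≡μ isE (ℕ.suc n) f = begin
  sum (λ v → productWeight w v ℚ.* f v) (cartesianProductWith _∷_ xs (allVecs xs n))
    ≡⟨ sum-cartesianProductWith (λ v → productWeight w v ℚ.* f v) _∷_ xs (allVecs xs n) ⟩
  sum (λ x → sum (λ v → w x ℚ.* productWeight w v ℚ.* f (x ∷ v)) (allVecs xs n)) xs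
    ≡⟨ sum-cong (λ x → trans
         (sum-cong (λ v → ℚ.*-assoc (w x) (productWeight w v) (f (x ∷ v))) (allVecs xs n))
         (sum-* (w x) (λ v → productWeight w v ℚ.* f (x ∷ v)) (allVecs xs n))) xs ⟩
  sum (λ x → w x ℚ.* sum (λ v → productWeight w v ℚ.* f (x ∷ v)) (allVecs xs n)) xs
    ≡⟨ sum≡μ _ ⟩
  μ (λ x → sum (λ v → productWeight w v ℚ.* f (x ∷ v)) (allVecs xs n))
    ≡⟨ IsExpectation.μ-cong isE (λ x → iid-sum w xs sum≡μ isE n (λ v → f (x ∷ v))) ⟩
  iid μ (ℕ.suc n) f ∎
  where open ≡-Reasoning

-- Evaluating `Pr` at the approximations of a real p

𝟙 : {P : Set} → Dec P → ℚ
𝟙 P? = if does P? then 1ℚ else 0ℚ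

approx-∑ : ∀ m xs → approx (∑ xs) m ≡ sum (λ x → approx x m) xs
approx-∑ m []       = refl
approx-∑ m (x ∷ xs) = cong (approx x m ℚ.+_) (approx-∑ m xs)

approx-∏ : ∀ m xs → approx (∏ xs) m ≡ product (map (λ x → approx x m) xs)
approx-∏ m []       = refl
approx-∏ m (x ∷ xs) = cong (approx x m ℚ.*_) (approx-∏ m xs)

approx-∏-allFin : ∀ m {n} (f : Fin n → ℝ) {g : Fin n → ℚ} → (∀ i → approx (f i) m ≡ g i) →
  approx (∏ (map f (allFin n))) m ≡ product (List.tabulate g)
approx-∏-allFin m {n} f {g} eq = begin
  approx (∏ (map f (allFin n))) m                   ≡⟨ approx-∏ m (map f (allFin n)) ⟩
  product (map (λ x → approx x m) (map f (allFin n)))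
    ≡⟨ cong product (sym (List.map-∘ (allFin n))) ⟩
  product (map (λ i → approx (f i) m) (allFin n))
    ≡⟨ cong product (List.map-cong eq (allFin n)) ⟩
  product (map g (allFin n))                        ≡⟨ cong product (List.map-tabulate (λ i → i) g) ⟩
  product (List.tabulate g)                         ∎
  where open ≡-Reasoning

bernoulliWeight : ℚ → Bool → ℚ
bernoulliWeight p b = if b then p else 1ℚ ℚ.- p

approx-weight : ∀ m {n} p (G : BipGraph n) →
  approx (weight p G) m ≡ productWeight (productWeight (bernoulliWeight (approx p m))) G
approx-weight m {n} p G = approx-∏-allFin m _ λ i → approx-∏-allFin m _ λ j → entry (edge G i j)
  where
  entry : ∀ b → approx (if b then p else 1ᴿ - p) m ≡ bernoulliWeight (approx p m) b
  entry true  = refl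
  entry false = refl

sum-filter : ∀ {A : Set} {P : A → Set} (P? : Decidable P) (f : A → ℚ) xs →
  sum f (filter P? xs) ≡ sum (λ x → f x ℚ.* 𝟙 (P? x)) xs
sum-filter P? f []       = refl
sum-filter P? f (x ∷ xs) with P? x
... | yes _ = cong₂ ℚ._+_ (sym (ℚ.*-identityʳ (f x))) (sum-filter P? f xs)
... | no  _ = trans (sum-filter P? f xs)
  (trans (sym (ℚ.+-identityˡ _)) (cong (ℚ._+ _) (sym (ℚ.*-zeroʳ (f x)))))

-- The operations of ℝ act on approximations index by index, and `Pr` is a polynomial in p. Hence
-- its approximation is exactly the same polynomial at the approximation of p, with no error term.
approx-Pr : ∀ m n p (A : BipGraph n → Set) (A? : Decidable A) →
  0ℚ ℚ.≤ approx p m → approx p m ℚ.≤ 1ℚ →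
  approx (Pr n p A A?) m ≡ Gnp n (approx p m) (λ G → 𝟙 (A? G))
approx-Pr m n p A A? 0≤p p≤1 = begin
  approx (∑ (map (weight p) (filter A? (allGraphs n)))) m
    ≡⟨ approx-∑ m (map (weight p) (filter A? (allGraphs n))) ⟩
  sum (λ x → approx x m) (map (weight p) (filter A? (allGraphs n)))
    ≡⟨ sum-map (λ x → approx x m) (weight p) (filter A? (allGraphs n)) ⟩
  sum (λ G → approx (weight p G) m) (filter A? (allGraphs n))
    ≡⟨ sum-filter A? (λ G → approx (weight p G) m) (allGraphs n) ⟩
  sum (λ G → approx (weight p G) m ℚ.* 𝟙 (A? G)) (allGraphs n)
    ≡⟨ sum-cong (λ G → cong (ℚ._* 𝟙 (A? G)) (approx-weight m p G)) (allGraphs n) ⟩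
  sum (λ G → productWeight (productWeight (bernoulliWeight q)) G ℚ.* 𝟙 (A? G)) (allGraphs n)
    ≡⟨ iid-sum (productWeight (bernoulliWeight q)) (allVecs (true ∷ false ∷ []) n)
         (iid-sum (bernoulliWeight q) (true ∷ false ∷ []) bernoulli-sum isE n)
         (iid-isExpectation isE n) n _ ⟩
  Gnp n q (λ G → 𝟙 (A? G)) ∎
  where
  open ≡-Reasoning
  q = approx p m
  isE = bernoulli-isExpectation 0≤p p≤1
  bernoulli-sum : ∀ f → sum (λ b → bernoulliWeight q b ℚ.* f b) (true ∷ false ∷ []) ≡ bernoulli q f
  bernoulli-sum f = cong (q ℚ.* f true ℚ.+_) (ℚ.+-identityʳ _)

unique-resp-↭ : ∀ {A : Set} {xs ys : List A} → xs ↭ ys → Unique xs → Unique ys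
unique-resp-↭ {A} p = Unique-resp-↭ (setoid A) (↭⇒↭ₛ p)

-- Edges along a walk

pathEdges : {A : Set} → List A → List (A × A)
pathEdges []            = []
pathEdges (x ∷ [])      = []
pathEdges (x ∷ y ∷ xs)  = (x , y) ∷ pathEdges (y ∷ xs)

module _ {A : Set} where

  pathEdges-++ : ∀ xs (w : A) ys →
    pathEdges (xs ++ w ∷ ys) ≡ pathEdges (xs ∷ʳ w) ++ pathEdges (w ∷ ys)
  pathEdges-++ []           w ys = refl
  pathEdges-++ (x ∷ [])     w ys = refl
  pathEdges-++ (x ∷ y ∷ xs) w ys = cong ((x , y) ∷_) (pathEdges-++ (y ∷ xs) w ys)

  pathEdges-∈ : ∀ (xs : List A) {u w} → (u , w) ∈ pathEdges xs → u ∈ xs × w ∈ xs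
  pathEdges-∈ (x ∷ y ∷ xs) (here refl) = here refl , there (here refl)
  pathEdges-∈ (x ∷ y ∷ xs) (there e∈) with pathEdges-∈ (y ∷ xs) e∈
  ... | u∈ , w∈ = there u∈ , there w∈

  pathEdges-tail : ∀ {P : A × A → Set} {x} xs → All P (pathEdges (x ∷ xs)) → All P (pathEdges xs)
  pathEdges-tail []       _       = []
  pathEdges-tail (y ∷ xs) (_ ∷ p) = p

  pathEdges-init : ∀ {P : A × A → Set} xs {z} → All P (pathEdges (xs ∷ʳ z)) → All P (pathEdges xs)
  pathEdges-init []           _        = []
  pathEdges-init (x ∷ [])     _        = []
  pathEdges-init (x ∷ y ∷ xs) (p ∷ ps) = p ∷ pathEdges-init (y ∷ xs) ps

steps≡pathEdges : ∀ {n} (v : Vertex n) vs → steps (v ∷ vs) ≡ pathEdges (v ∷ vs ∷ʳ v)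
steps≡pathEdges v vs = zip-pathEdges v vs
  where
  zip-pathEdges : ∀ u us → zip (u ∷ us) (us ∷ʳ v) ≡ pathEdges (u ∷ us ∷ʳ v)
  zip-pathEdges u []       = refl
  zip-pathEdges u (w ∷ us) = cong ((u , w) ∷_) (zip-pathEdges w us)

steps-∈ : ∀ {n} (c : List (Vertex n)) {u w} → (u , w) ∈ steps c → u ∈ c × w ∈ c
steps-∈ (v ∷ vs) e∈ with pathEdges-∈ (v ∷ vs ∷ʳ v) (subst (_ ∈_) (steps≡pathEdges v vs) e∈)
... | u∈ , w∈ = back u∈ , back w∈
  where
  back : ∀ {u} → u ∈ v ∷ vs ∷ʳ v → u ∈ v ∷ vs
  back u∈ with ∈-++⁻ (v ∷ vs) u∈
  ... | inj₁ u∈′         = u∈′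
  ... | inj₂ (here refl) = here refl

edgeOf-∈ : ∀ {n} (c : List (Vertex n)) {u w} → (u , w) EdgeOf c → u ∈ c × w ∈ c
edgeOf-∈ c (inj₁ e∈) = steps-∈ c e∈
edgeOf-∈ c (inj₂ e∈) = let w∈ , u∈ = steps-∈ c e∈ in u∈ , w∈

edgeOf-resp-↭ : ∀ {n} {c d : List (Vertex n)} {e} → steps c ↭ steps d → e EdgeOf c → e EdgeOf d
edgeOf-resp-↭ p (inj₁ e∈) = inj₁ (↭.∈-resp-↭ p e∈)
edgeOf-resp-↭ p (inj₂ e∈) = inj₂ (↭.∈-resp-↭ p e∈)

Walk : ∀ {n} → BipGraph n → List (Vertex n) → Set
Walk G xs = All (uncurry (Adj G)) (pathEdges xs)

adj-sym : ∀ {n} {G : BipGraph n} {u w} → Adj G u w → Adj G w u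
adj-sym (left-right e) = right-left e
adj-sym (right-left e) = left-right e

connected-sym : ∀ {n} {G : BipGraph n} {u w} → Connected G u w → Connected G w u
connected-sym = Star.reverse adj-sym

-- Distinct as undirected edges, so that in the random graph they are independent entries of the
-- matrix.
Different : {A : Set} → A × A → A × A → Set
Different (u , w) (x , y) = ¬ (u ≡ x × w ≡ y) × ¬ (u ≡ y × w ≡ x)

module _ {A : Set} where

  ∉⇒different : ∀ {u w : A} xs → u ∉ xs → All (Different (u , w)) (pathEdges xs)
  ∉⇒different xs u∉ = All.tabulate λ e∈ → let x∈ , y∈ = pathEdges-∈ xs e∈ in
    (λ { (refl , _) → u∉ x∈ }) , (λ { (refl , _) → u∉ y∈ })

  different-swap : ∀ {u w : A} {e} → Different (u , w) e → Different (w , u) e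
  different-swap (≢₁ , ≢₂) = (λ (p , q) → ≢₂ (q , p)) , (λ (p , q) → ≢₁ (q , p))

  unique-∉ : ∀ {x : A} {xs} → Unique (x ∷ xs) → x ∉ xs
  unique-∉ (x≢ ∷ _) x∈ = All.lookup x≢ x∈ refl

  ∈⇒¬unique : ∀ {z : A} {xs ys} → z ∈ xs → z ∈ ys → ¬ Unique (xs ++ ys)
  ∈⇒¬unique {xs = x ∷ xs} (here refl) z∈ys u       = unique-∉ u (∈-++⁺ʳ xs z∈ys)
  ∈⇒¬unique               (there z∈)  z∈ys (_ ∷ u) = ∈⇒¬unique z∈ z∈ys u

  unique⇒different : ∀ {xs : List A} → Unique xs → AllPairs Different (pathEdges xs)
  unique⇒different {[]}         _            = []
  unique⇒different {x ∷ []}     _            = []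
  unique⇒different {x ∷ y ∷ xs} uniq@(_ ∷ u) =
    ∉⇒different (y ∷ xs) (unique-∉ uniq) ∷ unique⇒different u

  -- A walk that turned back at once would return to the path along the edge just used; this
  -- condition makes the closing edge of a shape a new one.
  NonBacktracking : List A → Set
  NonBacktracking []               = ⊤
  NonBacktracking (x ∷ [])         = ⊤
  NonBacktracking (x ∷ y ∷ [])     = ⊤
  NonBacktracking (x ∷ y ∷ z ∷ xs) = x ≢ z × NonBacktracking (y ∷ z ∷ xs)

  unique⇒nonBacktracking : ∀ {xs : List A} → Unique xs → NonBacktracking xs
  unique⇒nonBacktracking {[]}             _                    = tt
  unique⇒nonBacktracking {x ∷ []}         _                    = tt
  unique⇒nonBacktracking {x ∷ y ∷ []}     _                    = tt
  unique⇒nonBacktracking {x ∷ y ∷ z ∷ xs} ((_ ∷ x≢z ∷ _) ∷ u) = x≢z , unique⇒nonBacktracking u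

  nonBacktracking-tail : ∀ {x : A} xs → NonBacktracking (x ∷ xs) → NonBacktracking xs
  nonBacktracking-tail []           _        = tt
  nonBacktracking-tail (y ∷ [])     _        = tt
  nonBacktracking-tail (y ∷ z ∷ xs) (_ , nb) = nb

  unique-shift : ∀ {x : A} xs → Unique (x ∷ xs) → Unique (xs ∷ʳ x)
  unique-shift {x} xs = unique-resp-↭ (↭.++-comm (x ∷ []) xs)

  -- Shifted by one, the closed list is a path, so its edges differ. The first edge contains y,
  -- which only the second edge meets again. A cycle on two vertices would use one edge twice, hence
  -- the length.
  closed-different : ∀ (x : A) xs → 3 ℕ.≤ length (x ∷ xs) → Unique (x ∷ xs) →
    AllPairs Different (pathEdges (x ∷ xs ∷ʳ x))
  closed-different x (y ∷ z ∷ xs) _ uniq@((x≢y ∷ x≢z ∷ _) ∷ _) =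
    (((λ (x≡y , _) → x≢y x≡y) , (λ (x≡z , _) → x≢z x≡z))
      ∷ All.map different-swap (∉⇒different (z ∷ xs ∷ʳ x) (unique-∉ shifted)))
    ∷ unique⇒different shifted
    where
    shifted = unique-shift (y ∷ z ∷ xs) uniq
  closed-different x []       (s≤s ())       _
  closed-different x (_ ∷ []) (s≤s (s≤s ())) _

  closed-nonBacktracking : ∀ (x : A) xs → 3 ℕ.≤ length (x ∷ xs) → Unique (x ∷ xs) →
    NonBacktracking (x ∷ xs ∷ʳ x)
  closed-nonBacktracking x (y ∷ z ∷ xs) _ uniq@((_ ∷ x≢z ∷ _) ∷ _) =
    x≢z , unique⇒nonBacktracking (unique-shift (y ∷ z ∷ xs) uniq)
  closed-nonBacktracking x []       (s≤s ())       _
  closed-nonBacktracking x (_ ∷ []) (s≤s (s≤s ())) _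

-- Rotating a cycle

record Rotation {n} (G : BipGraph n) (c : List (Vertex n)) (a : Vertex n) : Set where
  field
    rest      : List (Vertex n)
    isCycle   : IsCycle G (a ∷ rest)
    sameSteps : steps (a ∷ rest) ↭ steps c
    sameList  : a ∷ rest ↭ c

  walk : Walk G (a ∷ rest ∷ʳ a)
  walk = subst (All _) (steps≡pathEdges a rest) (proj₂ (proj₂ isCycle))

rotate : ∀ {n} {G : BipGraph n} {c a} → IsCycle G c → a ∈ c → Rotation G c a
rotate {c = c} {a} (3≤ , uniq , adj) a∈ with ∈-∃++ a∈
... | [] , bs , refl = record
  { rest = bs ; isCycle = 3≤ , uniq , adj ; sameSteps = ↭-refl ; sameList = ↭-refl }
... | h ∷ t , bs , refl = record
  { rest = bs ++ h ∷ t
  ; isCycle = subst (3 ℕ.≤_) (↭.↭-length (↭-sym same)) 3≤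
            , unique-resp-↭ (↭-sym same) uniq , ↭.All-resp-↭ (↭-sym sameSteps) adj
  ; sameSteps = sameSteps
  ; sameList = same
  }
  where
  same : (a ∷ bs) ++ h ∷ t ↭ h ∷ t ++ a ∷ bs
  same = ↭.++-comm (a ∷ bs) (h ∷ t)
  closed : ∀ x xs y ys → steps (x ∷ xs ++ y ∷ ys) ≡ pathEdges (x ∷ xs ∷ʳ y) ++ pathEdges (y ∷ ys ∷ʳ x)
  closed x xs y ys = trans (steps≡pathEdges x (xs ++ y ∷ ys))
    (trans (cong (pathEdges ∘ (x ∷_)) (List.++-assoc xs (y ∷ ys) (x ∷ [])))
           (pathEdges-++ (x ∷ xs) y (ys ∷ʳ x)))
  sameSteps : steps (a ∷ bs ++ h ∷ t) ↭ steps (h ∷ t ++ a ∷ bs)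
  sameSteps = ↭-trans (↭-reflexive (closed a bs h t))
    (↭-trans (↭.++-comm (pathEdges (a ∷ bs ∷ʳ h)) (pathEdges (h ∷ t ∷ʳ a)))
             (↭-reflexive (sym (closed h t a bs))))

-- Every complex component contains a shape

module _ {n : ℕ} (G : BipGraph n) where

  open MembershipDec (_≟ⱽ_ {n}) using (_∈?_)

  private
    V = Vertex n

  -- A nonbacktracking walk from u that ends by running once round the cycle d,
  -- so that its last vertex is met earlier as well.
  record WalkRound (d : List V) (u : V) : Set where
    field
      middle          : List V
      last            : V
      walk            : Walk G (u ∷ middle ∷ʳ last)
      nonBacktracking : NonBacktracking (u ∷ middle ∷ʳ last)
      last∈d          : last ∈ d
      round           : ∀ {e} → e ∈ steps d → e ∈ pathEdges (u ∷ middle ∷ʳ last)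
      -- In the first case the walk is the cycle d itself; knowing that its middle lies on d shows
      -- that a step from outside d is never undone at once.
      revisits        : (u ≡ last × All (_∈ d) middle) ⊎ last ∈ middle

  open WalkRound

  walkFromCycle : ∀ {d u} → IsCycle G d → u ∈ d → WalkRound d u
  walkFromCycle {d} {u} isC u∈ = record
    { middle = rest
    ; last   = u
    ; walk   = Rotation.walk r
    ; nonBacktracking = closed-nonBacktracking u rest (proj₁ isCycle) (proj₁ (proj₂ isCycle))
    ; last∈d = u∈
    ; round  = λ e∈ → subst (_ ∈_) (steps≡pathEdges u rest) (↭.∈-resp-↭ (↭-sym sameSteps) e∈)
    ; revisits = inj₁ (refl , All.tabulate λ x∈ → ↭.∈-resp-↭ sameList (there x∈))
    }
    where
    r = rotate isC u∈
    open Rotation r hiding (walk)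

  prependStep : ∀ {d u w} → Adj G u w → u ∉ d → (W : WalkRound d w) →
    NonBacktracking (u ∷ w ∷ middle W ∷ʳ last W) → WalkRound d u
  prependStep {d} {u} {w} a u∉ W nb = record
    { middle = w ∷ middle W ; last = last W ; walk = a ∷ walk W
    ; nonBacktracking = nb ; last∈d = last∈d W ; round = there ∘ round W
    ; revisits = inj₂ (revisit (revisits W)) }
    where
    revisit : (w ≡ last W × All (_∈ d) (middle W)) ⊎ last W ∈ middle W → last W ∈ w ∷ middle W
    revisit (inj₁ (refl , _)) = here refl
    revisit (inj₂ z∈)         = there z∈

  -- A step followed by its reversal cancels.
  extendWalk : ∀ {d u w} → Adj G u w → u ∉ d → WalkRound d w → WalkRound d u
  extendWalk {d} {u} {w} a u∉ W@record { middle = [] } = prependStep a u∉ W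
    ((λ { refl → u∉ (last∈d W) }) , nonBacktracking W)
  extendWalk {d} {u} {w} a u∉ W@record { middle = y ∷ l ; last = z } with u ≟ⱽ y
  ... | no u≢y = prependStep a u∉ W (u≢y , nonBacktracking W)
  ... | yes refl with revisits W
  ...   | inj₁ (_ , u∈ ∷ _)  = contradiction u∈ u∉
  ...   | inj₂ (here refl)   = contradiction (last∈d W) u∉
  ...   | inj₂ (there z∈) = record
    { middle = l ; last = z ; walk = All.tail (walk W)
    ; nonBacktracking = nonBacktracking-tail (u ∷ l ∷ʳ z) (nonBacktracking W)
    ; last∈d = last∈d W ; round = λ e∈ → drop e∈ (round W e∈) ; revisits = inj₂ z∈ }
    where
    -- The cancelled edge contains u, which is not on d, so no edge of d is lost.
    drop : ∀ {e} → e ∈ steps d → e ∈ (w , u) ∷ pathEdges (u ∷ l ∷ʳ z) → e ∈ pathEdges (u ∷ l ∷ʳ z)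
    drop e∈ (here refl) = contradiction (proj₂ (steps-∈ d e∈)) u∉
    drop e∈ (there e∈′) = e∈′

  walkRound : ∀ {d u w} → IsCycle G d → Connected G u w → w ∈ d → WalkRound d u
  walkRound isC stay    w∈ = walkFromCycle isC w∈
  walkRound {d} {u} isC (a ◅ p) w∈ with u ∈? d
  ... | yes u∈ = walkFromCycle isC u∈
  ... | no  u∉ = extendWalk a u∉ (walkRound isC p w∈)

  -- The part of a walk from the moment it leaves c. The field `repeats` guarantees that it meets c
  -- or itself again, which is what stops the growth of the path.
  record Exit (c : List V) : Set where
    field
      from to         : V
      later           : List V
      walk            : Walk G (from ∷ to ∷ later)
      nonBacktracking : NonBacktracking (from ∷ to ∷ later)
      from∈c          : from ∈ c
      leaves          : ¬ (from , to) EdgeOf c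
      repeats         : ¬ Unique ((to ∷ later) ++ c)

  -- Follow the walk while its edges belong to c. The edge e does not, so the walk must leave; until
  -- then its end z stays on c or among the interior vertices still ahead.
  exit : ∀ c u l z {e} → Walk G (u ∷ l ∷ʳ z) → NonBacktracking (u ∷ l ∷ʳ z) →
    u ∈ c → z ∈ c ⊎ z ∈ l → e ∈ pathEdges (u ∷ l ∷ʳ z) → ¬ e EdgeOf c → Exit c
  exit c u l z w nb u∈ z∈ e∈ ¬e with l
  exit c u l z w nb u∈ (inj₁ z∈) (here refl) ¬e | [] = record
    { from = u ; to = z ; later = [] ; walk = w ; nonBacktracking = nb ; from∈c = u∈ ; leaves = ¬e
    ; repeats = ∈⇒¬unique (here refl) z∈ }
  ... | y ∷ l′ with edgeOf? c (u , y)
  ...   | yes uy = exit c y l′ z (All.tail w) (nonBacktracking-tail (y ∷ l′ ∷ʳ z) nb) y∈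
                     (advance z∈) (other e∈) ¬e
    where
    y∈ = proj₂ (edgeOf-∈ c uy)
    advance : z ∈ c ⊎ z ∈ y ∷ l′ → z ∈ c ⊎ z ∈ l′
    advance (inj₁ z∈)          = inj₁ z∈
    advance (inj₂ (here refl)) = inj₁ y∈
    advance (inj₂ (there z∈))  = inj₂ z∈
    other : _ ∈ pathEdges (u ∷ y ∷ l′ ∷ʳ z) → _ ∈ pathEdges (y ∷ l′ ∷ʳ z)
    other (here refl) = contradiction uy ¬e
    other (there e∈)  = e∈
  ...   | no ¬uy = record
    { from = u ; to = y ; later = l′ ∷ʳ z
    ; walk = w ; nonBacktracking = nb ; from∈c = u∈ ; leaves = ¬uy
    ; repeats = repeat z∈ }
    where
    repeat : z ∈ c ⊎ z ∈ y ∷ l′ → ¬ Unique ((y ∷ l′ ∷ʳ z) ++ c)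
    repeat (inj₁ z∈) = ∈⇒¬unique (∈-++⁺ʳ (y ∷ l′) (here refl)) z∈
    repeat (inj₂ z∈) u = ∈⇒¬unique z∈ (here refl)
      (subst Unique (List.++-assoc (y ∷ l′) (z ∷ []) c) u)

  -- A minimal complex subgraph: a path together with one further edge at each
  -- of its ends, leading back to the vertices z₁ and z₂ of the path.
  shapeEdges : List V → V → V → List (V × V)
  shapeEdges xs z₁ z₂ = pathEdges (z₂ ∷ xs ∷ʳ z₁)

  record Shape (root : V) : Set where
    field
      path      : List V
      z₁ z₂     : V
      unique    : Unique path
      z₁∈       : z₁ ∈ path
      z₂∈       : z₂ ∈ path
      different : AllPairs Different (shapeEdges path z₁ z₂)
      present   : All (uncurry (Adj G)) (shapeEdges path z₁ z₂)
      connected : Connected G root z₁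

  -- Follow the walk, adding its vertices to the path, until it meets the path.
  grow : ∀ {root} v xs z → Unique (v ∷ xs) → z ∈ v ∷ xs → Connected G root z →
    AllPairs Different (pathEdges (v ∷ xs ∷ʳ z)) → Walk G (v ∷ xs ∷ʳ z) →
    ∀ y ys → Walk G (v ∷ y ∷ ys) → NonBacktracking (v ∷ y ∷ ys) →
    All (Different (y , v)) (pathEdges (v ∷ xs ∷ʳ z)) → ¬ Unique ((y ∷ ys) ++ v ∷ xs) →
    Shape root
  grow v xs z uniq z∈ conn diff walk y ys (vy ∷ w) nb new rep with y ∈? (v ∷ xs)
  ... | yes y∈ = record
    { path = v ∷ xs ; z₁ = z ; z₂ = y ; unique = uniq ; z₁∈ = z∈ ; z₂∈ = y∈
    ; different = new ∷ diff ; present = adj-sym vy ∷ walk ; connected = conn }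
  ... | no y∉ with ys
  ...   | []       = contradiction (All.¬Any⇒All¬ (v ∷ xs) y∉ ∷ uniq) rep
  ...   | y′ ∷ ys′ =
    grow y (v ∷ xs) z (All.¬Any⇒All¬ (v ∷ xs) y∉ ∷ uniq) (there z∈) conn (new ∷ diff)
      (adj-sym vy ∷ walk) y′ ys′ w (nonBacktracking-tail (y ∷ y′ ∷ ys′) nb)
      -- The next edge is new: it can agree with the edge between y and v only if y′ is v, which
      -- would be backtracking, and no older edge contains y.
      (((λ (_ , y≡v) → y∉ (here y≡v)) , (λ (y′≡v , _) → proj₁ nb (sym y′≡v)))
        ∷ All.map different-swap (∉⇒different (v ∷ xs ∷ʳ z) y∉closed))
      (rep ∘ unique-resp-↭ (↭.shift y (y′ ∷ ys′) (v ∷ xs)))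
    where
    y∉closed : y ∉ v ∷ xs ∷ʳ z
    y∉closed y∈ with ∈-++⁻ (v ∷ xs) y∈
    ... | inj₁ y∈′         = y∉ y∈′
    ... | inj₂ (here refl) = y∉ z∈

  -- The cycle, cut open at the vertex where the walk leaves it, is the initial path; the edge
  -- closing the cycle is the one leading back to z₁. New vertices are added at the other end.
  exit⇒shape : ∀ {root c} → CycleInComponent G root c → Exit c → Shape root
  exit⇒shape {root} {c} (isC , conn) E =
    grow from rest from uniq (here refl) (All.lookup conn from∈c)
      (closed-different from rest (proj₁ isCycle) uniq) (Rotation.walk r)
      to later (Exit.walk E) (Exit.nonBacktracking E)
      (subst (All _) (steps≡pathEdges from rest) (All.tabulate λ e∈ →
          (λ { (refl , refl) → leaves (inj₂ (↭.∈-resp-↭ sameSteps e∈)) })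
        , (λ { (refl , refl) → leaves (inj₁ (↭.∈-resp-↭ sameSteps e∈)) })))
      (repeats ∘ unique-resp-↭ (↭.++⁺ˡ (to ∷ later) sameList))
    where
    open Exit E hiding (walk; nonBacktracking)
    r = rotate isC from∈c
    open Rotation r hiding (walk)
    uniq = proj₁ (proj₂ isCycle)

  -- A walk from a vertex of c that runs once round d traverses every edge of d, in particular e,
  -- and so must leave c.
  newEdge⇒shape : ∀ {root c d e} → CycleInComponent G root c → CycleInComponent G root d →
    e ∈ steps d → ¬ e EdgeOf c → Shape root
  newEdge⇒shape {c = []} ((() , _) , _)
  newEdge⇒shape {d = []} _ ((() , _) , _)
  newEdge⇒shape {c = u ∷ us} {w ∷ ws} C@(_ , cu ∷ _) (isD , dw ∷ _) e∈ ¬e =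
    exit⇒shape C (exit (u ∷ us) u (middle W) (last W) (walk W) (nonBacktracking W) (here refl)
      (start (revisits W)) (round W e∈) ¬e)
    where
    W = walkRound isD (connected-sym cu ◅◅ dw) (here refl)
    start : (u ≡ last W × All (_∈ w ∷ ws) (middle W)) ⊎ last W ∈ middle W →
      last W ∈ u ∷ us ⊎ last W ∈ middle W
    start (inj₁ (u≡z , _)) = inj₁ (here (sym u≡z))
    start (inj₂ z∈)        = inj₂ z∈

  complex⇒shape : ∀ {root} → ComplexComponent G root → Shape root
  complex⇒shape (c , C , d , D , ¬same) with All.all? (edgeOf? d) (steps c)
  ... | no ¬c⊆d = let e , e∈ , ¬e = find (All.¬All⇒Any¬ (edgeOf? d) (steps c) ¬c⊆d) in
    newEdge⇒shape D C e∈ ¬e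
  ... | yes c⊆d with All.all? (edgeOf? c) (steps d)
  ...   | no ¬d⊆c = let e , e∈ , ¬e = find (All.¬All⇒Any¬ (edgeOf? c) (steps d) ¬d⊆c) in
    newEdge⇒shape C D e∈ ¬e
  ...   | yes d⊆c = contradiction (c⊆d , d⊆c) ¬same

-- Indicators and counting in lists

𝟙-yes : ∀ {P : Set} (P? : Dec P) → P → 𝟙 P? ≡ 1ℚ
𝟙-yes (yes _) _ = refl
𝟙-yes (no ¬p) p = contradiction p ¬p

𝟙-no : ∀ {P : Set} (P? : Dec P) → ¬ P → 𝟙 P? ≡ 0ℚ
𝟙-no (yes p) ¬p = contradiction p ¬p
𝟙-no (no _)  _  = refl

0≤𝟙 : ∀ {P : Set} (P? : Dec P) → 0ℚ ℚ.≤ 𝟙 P?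
0≤𝟙 (yes _) = ℚ.nonNegative⁻¹ 1ℚ
0≤𝟙 (no _)  = ℚ.≤-refl

𝟙≤1 : ∀ {P : Set} (P? : Dec P) → 𝟙 P? ℚ.≤ 1ℚ
𝟙≤1 (yes _) = ℚ.≤-refl
𝟙≤1 (no _)  = ℚ.nonNegative⁻¹ 1ℚ

module _ {A : Set} where

  filter-split : ∀ {P : A → Set} (P? : Decidable P) xs → filter P? xs ++ filter (¬? ∘ P?) xs ↭ xs
  filter-split P? []       = ↭-refl
  filter-split P? (x ∷ xs) with P? x
  ... | yes _ = prep x (filter-split P? xs)
  ... | no  _ = ↭-trans (↭.shift x (filter P? xs) _) (prep x (filter-split P? xs))

  unique-++⁻ʳ : ∀ (xs : List A) {ys} → Unique (xs ++ ys) → Unique ys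
  unique-++⁻ʳ []       u       = u
  unique-++⁻ʳ (x ∷ xs) (_ ∷ u) = unique-++⁻ʳ xs u

  complement : ∀ (xs ys : List A) → Unique xs → (∀ {x} → x ∈ xs → x ∈ ys) → ∃ λ zs → xs ++ zs ↭ ys
  complement []       ys _              xs⊆ys = ys , ↭-refl
  complement (x ∷ xs) ys uniq@(_ ∷ u) xs⊆ys with ∈-∃++ (xs⊆ys (here refl))
  ... | ps , qs , refl with complement xs (ps ++ qs) u (λ y∈ → remove y∈ (↭.∈-resp-↭ (↭.shift x ps qs) (xs⊆ys (there y∈))))
    where
    remove : ∀ {y} → y ∈ xs → y ∈ x ∷ ps ++ qs → y ∈ ps ++ qs
    remove y∈ (here refl) = contradiction y∈ (unique-∉ uniq)
    remove y∈ (there y∈′) = y∈′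
  ...   | zs , p = zs , ↭-trans (prep x p) (↭-sym (↭.shift x ps qs))

  length-filter-↭ : ∀ {P : A → Set} (P? : Decidable P) xs ys {zs} → xs ++ ys ↭ zs →
    length (filter P? zs) ≡ length (filter P? xs) ℕ.+ length (filter P? ys)
  length-filter-↭ P? xs ys p = trans (sym (↭.↭-length (↭.filter-↭ P? p)))
    (trans (cong length (List.filter-++ P? xs ys)) (List.length-++ (filter P? xs)))

length-pathEdges : ∀ {A : Set} (x : A) xs → length (pathEdges (x ∷ xs)) ≡ length xs
length-pathEdges x []       = refl
length-pathEdges x (y ∷ xs) = cong ℕ.suc (length-pathEdges y xs)

vertices-unique : ∀ n → Unique (vertices n)
vertices-unique n = Unique.++⁺
  (Unique.map⁺ Sum.inj₁-injective (Unique.allFin⁺ n))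
  (Unique.map⁺ Sum.inj₂-injective (Unique.allFin⁺ n))
  λ (v∈₁ , v∈₂) → absurd (∈-map⁻ inj₁ v∈₁) (∈-map⁻ inj₂ v∈₂)
  where
  absurd : ∀ {v : Vertex n} → (∃ λ i → i ∈ allFin n × v ≡ inj₁ i) →
           ¬ (∃ λ j → j ∈ allFin n × v ≡ inj₂ j)
  absurd (_ , _ , refl) (_ , _ , ())

-- The edge indicators of a graph

data Opposite {n} : Vertex n → Vertex n → Set where
  lr : ∀ {i j} → Opposite (inj₁ i) (inj₂ j)
  rl : ∀ {i j} → Opposite (inj₂ j) (inj₁ i)

opposite? : ∀ {n} (u w : Vertex n) → Dec (Opposite u w)
opposite? (inj₁ i) (inj₂ j) = yes lr
opposite? (inj₂ j) (inj₁ i) = yes rl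
opposite? (inj₁ _) (inj₁ _) = no λ ()
opposite? (inj₂ _) (inj₂ _) = no λ ()

length-map-allFin : ∀ {n} {A : Set} (f : Fin n → A) → length (map f (allFin n)) ≡ n
length-map-allFin {n} f = trans (List.length-map f (allFin n)) (List.length-tabulate id)

length-opposite : ∀ n (a : Vertex n) → length (filter (opposite? a) (vertices n)) ≡ n
length-opposite n a = trans
  (length-filter-↭ (opposite? a) (map inj₁ (allFin n)) (map inj₂ (allFin n)) ↭-refl) (counts a)
  where
  all : ∀ {P : Vertex n → Set} (f : Fin n → Vertex n) → (∀ i → P (f i)) → All P (map f (allFin n))
  all f p = All.map⁺ (All.tabulate λ {i} _ → p i)
  counts : ∀ a → length (filter (opposite? a) (map inj₁ (allFin n))) ℕ.+
                 length (filter (opposite? a) (map inj₂ (allFin n))) ≡ n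
  counts (inj₁ i) = cong₂ ℕ._+_
    (cong length (List.filter-none (opposite? (inj₁ i)) (all inj₁ λ _ ())))
    (trans (cong length (List.filter-all (opposite? (inj₁ i)) (all inj₂ λ _ → lr))) (length-map-allFin inj₂))
  counts (inj₂ j) = trans (cong₂ ℕ._+_
    (trans (cong length (List.filter-all (opposite? (inj₂ j)) (all inj₁ λ _ → rl))) (length-map-allFin inj₁))
    (cong length (List.filter-none (opposite? (inj₂ j)) (all inj₂ λ _ ())))) (ℕ.+-identityʳ n)

adj⇒opposite : ∀ {n} {G : BipGraph n} {u w} → Adj G u w → Opposite u w
adj⇒opposite (left-right _) = lr
adj⇒opposite (right-left _) = rl

joined : ∀ {n} → BipGraph n → Vertex n → Vertex n → Bool
joined G (inj₁ i) (inj₂ j) = edge G i j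
joined G (inj₂ j) (inj₁ i) = edge G i j
joined G (inj₁ _) (inj₁ _) = false
joined G (inj₂ _) (inj₂ _) = false

joined⇒adj : ∀ {n} (G : BipGraph n) u w → joined G u w ≡ true → Adj G u w
joined⇒adj G (inj₁ i) (inj₂ j) eq = left-right (subst T (sym eq) tt)
joined⇒adj G (inj₂ j) (inj₁ i) eq = right-left (subst T (sym eq) tt)

adj⇒joined : ∀ {n} {G : BipGraph n} {u w} → Adj G u w → joined G u w ≢ false
adj⇒joined (left-right e) eq = subst T eq e
adj⇒joined (right-left e) eq = subst T eq e

-- On two vertices of one class this is the identity, so that redrawing holds for all pairs of
-- vertices.
setJoined : ∀ {n} → Vertex n → Vertex n → Bool → BipGraph n → BipGraph n
setJoined (inj₁ i) (inj₂ j) b = setEdge i j b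
setJoined (inj₂ j) (inj₁ i) b = setEdge i j b
setJoined (inj₁ _) (inj₁ _) b = id
setJoined (inj₂ _) (inj₂ _) b = id

edge-setEdge : ∀ {n} i j b (G : BipGraph n) → edge (setEdge i j b G) i j ≡ b
edge-setEdge i j b G = trans (cong (λ row → lookup row j) (Vec.lookup∘updateAt i G))
                             (Vec.lookup∘updateAt j (lookup G i))

edge-setEdge-other : ∀ {n} i j b i′ j′ (G : BipGraph n) → ¬ (i ≡ i′ × j ≡ j′) →
  edge (setEdge i j b G) i′ j′ ≡ edge G i′ j′
edge-setEdge-other i j b i′ j′ G ≢ with i Fin.≟ i′
... | yes refl = trans (cong (λ row → lookup row j′) (Vec.lookup∘updateAt i G))
                       (Vec.lookup∘updateAt′ j′ j (λ j′≡j → ≢ (refl , sym j′≡j)) (lookup G i))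
... | no i≢i′ = cong (λ row → lookup row j′) (Vec.lookup∘updateAt′ i′ i (i≢i′ ∘ sym) G)

joined-setJoined : ∀ {n} {u w : Vertex n} → Opposite u w → ∀ b G → joined (setJoined u w b G) u w ≡ b
joined-setJoined lr b G = edge-setEdge _ _ b G
joined-setJoined rl b G = edge-setEdge _ _ b G

joined-setJoined-false : ∀ {n} (u w : Vertex n) G → joined (setJoined u w false G) u w ≡ false
joined-setJoined-false (inj₁ i) (inj₂ j) G = edge-setEdge i j false G
joined-setJoined-false (inj₂ j) (inj₁ i) G = edge-setEdge i j false G
joined-setJoined-false (inj₁ _) (inj₁ _) G = refl
joined-setJoined-false (inj₂ _) (inj₂ _) G = refl

joined-setJoined-other : ∀ {n} (u w : Vertex n) b x y G → Different (u , w) (x , y) →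
  joined (setJoined u w b G) x y ≡ joined G x y
joined-setJoined-other (inj₁ i) (inj₂ j) b (inj₁ i′) (inj₂ j′) G (≢ , _) =
  edge-setEdge-other i j b i′ j′ G λ { (refl , refl) → ≢ (refl , refl) }
joined-setJoined-other (inj₁ i) (inj₂ j) b (inj₂ j′) (inj₁ i′) G (_ , ≢) =
  edge-setEdge-other i j b i′ j′ G λ { (refl , refl) → ≢ (refl , refl) }
joined-setJoined-other (inj₂ j) (inj₁ i) b (inj₁ i′) (inj₂ j′) G (_ , ≢) =
  edge-setEdge-other i j b i′ j′ G λ { (refl , refl) → ≢ (refl , refl) }
joined-setJoined-other (inj₂ j) (inj₁ i) b (inj₂ j′) (inj₁ i′) G (≢ , _) =
  edge-setEdge-other i j b i′ j′ G λ { (refl , refl) → ≢ (refl , refl) }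
joined-setJoined-other u w b (inj₁ _) (inj₁ _) G _ = refl
joined-setJoined-other u w b (inj₂ _) (inj₂ _) G _ = refl
joined-setJoined-other (inj₁ _) (inj₁ _) b (inj₁ _) (inj₂ _) G _ = refl
joined-setJoined-other (inj₁ _) (inj₁ _) b (inj₂ _) (inj₁ _) G _ = refl
joined-setJoined-other (inj₂ _) (inj₂ _) b (inj₁ _) (inj₂ _) G _ = refl
joined-setJoined-other (inj₂ _) (inj₂ _) b (inj₂ _) (inj₁ _) G _ = refl

joinAll : ∀ {n} → List (Vertex n × Vertex n) → BipGraph n → BipGraph n
joinAll []            = id
joinAll ((u , w) ∷ D) = setJoined u w true ∘ joinAll D

joined-joinAll-other : ∀ {n} D x y (G : BipGraph n) → All (λ e → Different e (x , y)) D →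
  joined (joinAll D G) x y ≡ joined G x y
joined-joinAll-other []            x y G []           = refl
joined-joinAll-other ((u , w) ∷ D) x y G (diff ∷ diffs) =
  trans (joined-setJoined-other u w true x y (joinAll D G) diff) (joined-joinAll-other D x y G diffs)

joined-joinAll : ∀ {n} D (G : BipGraph n) → AllPairs Different D → All (uncurry Opposite) D →
  All (λ (x , y) → joined (joinAll D G) x y ≡ true) D
joined-joinAll []            G []           []           = []
joined-joinAll ((u , w) ∷ D) G (diff ∷ diffs) (opp ∷ opps) =
  joined-setJoined opp true (joinAll D G) ∷
  All.zipWith (λ {e} (d , eq) →
      trans (joined-setJoined-other u w true (proj₁ e) (proj₂ e) (joinAll D G) d) eq)
    (diff , joined-joinAll D G diffs opps)

walk⇒connected : ∀ {n} {G : BipGraph n} xs {z x} → Walk G (xs ∷ʳ z) → x ∈ xs → Connected G x z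
walk⇒connected (u ∷ [])     (a ∷ []) (here refl) = a ◅ stay
walk⇒connected (u ∷ y ∷ xs) (a ∷ w)  (here refl) = a ◅ walk⇒connected (y ∷ xs) w (here refl)
walk⇒connected (u ∷ y ∷ xs) (a ∷ w)  (there x∈)  = walk⇒connected (y ∷ xs) w x∈

-- Conditioning and exploration in G(n,n,p)

module Exploration {n : ℕ} {p : ℚ} (0≤p : 0ℚ ℚ.≤ p) (p≤1 : p ℚ.≤ 1ℚ) where

  E : (BipGraph n → ℚ) → ℚ
  E = Gnp n p

  open IsExpectation (Gnp-isExpectation n 0≤p p≤1)

  -- The law of total expectation for one edge, free of division.
  redraw : ∀ u w f →
    E f ≡ p ℚ.* E (f ∘ setJoined u w true) ℚ.+ (1ℚ ℚ.- p) ℚ.* E (f ∘ setJoined u w false)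
  redraw (inj₁ i) (inj₂ j) f = Gnp-redraws {n} 0≤p p≤1 i j f
  redraw (inj₂ j) (inj₁ i) f = Gnp-redraws {n} 0≤p p≤1 i j f
  redraw (inj₁ _) (inj₁ _) f = solve 2 (λ p e → e := p :* e :+ (con 1ℚ :- p) :* e) refl p (E f)
  redraw (inj₂ _) (inj₂ _) f = solve 2 (λ p e → e := p :* e :+ (con 1ℚ :- p) :* e) refl p (E f)

  -- Redraw the edges of D one at a time: the branch in which the edge is absent vanishes, and as
  -- the edges differ, fixing one leaves the hypothesis on the others intact.
  condition-on-edges : ∀ D f → AllPairs Different D →
    (∀ {u w} → (u , w) ∈ D → ∀ G → joined G u w ≡ false → f G ≡ 0ℚ) →
    E f ≡ p ^ℚ length D ℚ.* E (f ∘ joinAll D)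
  condition-on-edges []            f []             f≡0 = sym (ℚ.*-identityˡ (E f))
  condition-on-edges ((u , w) ∷ D) f (diff ∷ diffs) f≡0 = begin
    E f ≡⟨ redraw u w f ⟩
    p ℚ.* E (f ∘ setJoined u w true) ℚ.+ (1ℚ ℚ.- p) ℚ.* E (f ∘ setJoined u w false)
      ≡⟨ cong₂ (λ x y → p ℚ.* x ℚ.+ (1ℚ ℚ.- p) ℚ.* y)
           (condition-on-edges D (f ∘ setJoined u w true) diffs λ {x} {y} e∈ G eq →
              f≡0 (there e∈) _ (trans (joined-setJoined-other u w true x y G (All.lookup diff e∈)) eq))
           (trans (μ-cong λ G → f≡0 (here refl) _ (joined-setJoined-false u w G)) (unit 0ℚ)) ⟩
    p ℚ.* (P ℚ.* e) ℚ.+ (1ℚ ℚ.- p) ℚ.* 0ℚ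
      ≡⟨ solve 3 (λ p P e → p :* (P :* e) :+ (con 1ℚ :- p) :* con 0ℚ := p :* P :* e) refl p P e ⟩
    p ℚ.* P ℚ.* e ∎
    where
    open ≡-Reasoning
    P = p ^ℚ length D
    e = E (f ∘ joinAll ((u , w) ∷ D))

  -- The edge has not been revealed: redrawing it in G redraws it in σ G.
  Fresh : (BipGraph n → BipGraph n) → Vertex n → Vertex n → Set
  Fresh σ x y = ∀ G → joined (σ G) x y ≡ joined G x y

  fresh-step : ∀ σ u w b x y → Different (u , w) (x , y) → Fresh σ x y →
    Fresh (σ ∘ setJoined u w b) x y
  fresh-step σ u w b x y d fr G = trans (fr _) (joined-setJoined-other u w b x y G d)

  -- The component of root is explored edge by edge.  X holds the processed
  -- vertices, A the active ones and U the vertices not yet found; σ overwrites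
  -- the edges revealed so far by their revealed values.  Each vertex is
  -- processed by scanning the vertices P of the opposite class not yet found,
  -- and θ ^ |A| · (1 - p + p θ) ^ |P| is a martingale along the scan.
  module _ {Small : ℕ → Set} (small? : Decidable Small)
           (small-↓ : ∀ {s t} → s ℕ.≤ t → Small t → Small s)
           {θ : ℚ} (0≤θ : 0ℚ ℚ.≤ θ)
           (drift : ∀ r s → Small s → n ℕ.≤ r ℕ.+ s → ((1ℚ ℚ.- p) ℚ.+ p ℚ.* θ) ^ℚ r ℚ.≤ θ)
           (root : Vertex n) (f : BipGraph n → ℚ) (f≤1 : ∀ G → f G ℚ.≤ 1ℚ)
           (f≡0 : ∀ G → ¬ Small (order G root) → f G ≡ 0ℚ) where

    private
      V = Vertex n
      decay = (1ℚ ℚ.- p) ℚ.+ p ℚ.* θ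

    -- Only edges into U are ever scanned, so freshness is recorded for these alone. The vertex
    -- being processed already belongs to X; the freshness of its edges is carried along by `scan`.
    record Known (σ : BipGraph n → BipGraph n) (X A U : List V) : Set where
      field
        partition : X ++ A ++ U ↭ vertices n
        reached   : ∀ G {x} → x ∈ X ++ A → Connected (σ G) root x
        fresh     : ∀ {x u} → x ∈ A ++ U → u ∈ U → Fresh σ x u

    open Known

    unique-known : ∀ {σ X A U} → Known σ X A U → Unique (X ++ A ++ U)
    unique-known K = unique-resp-↭ (↭-sym (partition K)) (vertices-unique n)

    found≤order : ∀ {σ X A U} → Known σ X A U → ∀ G → length (X ++ A) ℕ.≤ order (σ G) root
    found≤order {σ} {X} {A} {U} K G = begin
      length (X ++ A)                       ≡⟨ cong length (List.filter-all c? (All.tabulate (reached K G))) ⟨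
      length (filter c? (X ++ A))           ≤⟨ ℕ.m≤m+n _ _ ⟩
      length (filter c? (X ++ A)) ℕ.+ length (filter c? U)
        ≡⟨ length-filter-↭ c? (X ++ A) U (↭-trans (↭-reflexive (List.++-assoc X A U)) (partition K)) ⟨
      order (σ G) root                      ∎
      where
      open ℕ.≤-Reasoning
      c? = connected? (σ G) root

    -- The edge just revealed has its end a in X, while `fresh` concerns pairs outside X.
    still-fresh : ∀ {σ X A U a u b} {B W : List V} → a ∈ X → Known σ X A U → u ∈ U →
      (∀ {x} → x ∈ B → x ∈ A ++ U) → (∀ {w} → w ∈ W → w ∈ U) →
      ∀ {x w} → x ∈ B → w ∈ W → Fresh (σ ∘ setJoined a u b) x w
    still-fresh {σ} {X} {A} {U} {a} {u} {b} a∈ K u∈ B⊆ W⊆ {x} {w} x∈ w∈ =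
      fresh-step σ a u b x w
        ((λ { (refl , _) → a∉ (B⊆ x∈) }) , (λ { (refl , _) → a∉ (∈-++⁺ʳ A (W⊆ w∈)) }))
        (fresh K (B⊆ x∈) (W⊆ w∈))
      where
      a∉ : a ∉ A ++ U
      a∉ a∈′ = ∈⇒¬unique a∈ a∈′ (unique-known K)

    scan-true : ∀ {σ X A U a u} → a ∈ X → Opposite a u → Known σ X A (u ∷ U) → Fresh σ a u →
      Known (σ ∘ setJoined a u true) X (u ∷ A) U
    scan-true {σ} {X} {A} {U} {a} {u} a∈ opp K fr = record
      { partition = ↭-trans (↭.++⁺ˡ X (↭-sym move)) (partition K)
      ; reached   = λ G x∈ → reach G (↭.∈-resp-↭ (↭.shift u X A) x∈)
      ; fresh     = still-fresh a∈ K (here refl) (↭.∈-resp-↭ (↭-sym move)) there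
      }
      where
      move : A ++ u ∷ U ↭ u ∷ A ++ U
      move = ↭.shift u A U
      reach : ∀ G {x} → x ∈ u ∷ X ++ A → Connected (σ (setJoined a u true G)) root x
      reach G (there x∈)  = reached K _ x∈
      reach G (here refl) = reached K _ (∈-++⁺ˡ a∈) ◅◅ joined⇒adj _ a u
        (trans (fr _) (joined-setJoined opp true G)) ◅ stay

    scan-false : ∀ {σ X A U U′ a u} → a ∈ X → Known σ X A U → u ∈ U → U ↭ U′ →
      Known (σ ∘ setJoined a u false) X A U′
    scan-false {X = X} {A} a∈ K u∈ U↭ = record
      { partition = ↭-trans (↭.++⁺ˡ X (↭.++⁺ˡ A (↭-sym U↭))) (partition K)
      ; reached   = λ G → reached K _
      ; fresh     = still-fresh a∈ K u∈ (↭.∈-resp-↭ (↭.++⁺ˡ A (↭-sym U↭))) (↭.∈-resp-↭ (↭-sym U↭))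
      }

    scan-fresh : ∀ {σ X A U P a u b} → a ∈ X → Known σ X A (u ∷ U) → (∀ {w} → w ∈ P → w ∈ U) →
      All (Fresh σ a) P → All (Fresh (σ ∘ setJoined a u b) a) P
    scan-fresh {σ} {X} {A} {U} {P} {a} {u} {b} a∈ K P⊆ frs = All.tabulate λ {w} w∈ →
      fresh-step σ a u b a w
        ((λ { (_ , refl) → unique-∉ (unique-++⁻ʳ A (unique-++⁻ʳ X (unique-known K))) (P⊆ w∈) })
        , (λ { (refl , _) → ∈⇒¬unique a∈ (∈-++⁺ʳ A (there (P⊆ w∈))) (unique-known K) }))
        (All.lookup frs w∈)

    -- The number k bounds the unprocessed vertices and decreases with each processed one. When no
    -- vertex is active the exploration is over, and the bound is θ⁰ = 1.
    explore : ∀ k σ X A U → length (A ++ U) ℕ.≤ k → Known σ X A U → E (f ∘ σ) ℚ.≤ θ ^ℚ length A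
    scan : ∀ k σ X A P R a → length (A ++ P ++ R) ℕ.≤ k → Known σ X A (P ++ R) → a ∈ X →
      All (Opposite a) P → All (Fresh σ a) P → E (f ∘ σ) ℚ.≤ θ ^ℚ length A ℚ.* decay ^ℚ length P

    explore k σ X [] U _ K = subst (E (f ∘ σ) ℚ.≤_) (unit 1ℚ) (mono λ G → f≤1 (σ G))
    explore (ℕ.suc k) σ X (a ∷ A) U (s≤s len) K with small? (length (X ++ a ∷ A))
    -- The vertices found lie in the component of the root whatever the unrevealed edges are, so it
    -- is already too large and f vanishes.
    ... | no ¬small = subst (ℚ._≤ θ ^ℚ ℕ.suc (length A))
      (sym (trans (μ-cong λ G → f≡0 (σ G) (¬small ∘ small-↓ (found≤order K G))) (unit 0ℚ)))
      (0≤^ (ℕ.suc (length A)) 0≤θ)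
    ... | yes small = begin
      E (f ∘ σ)
        ≤⟨ scan k σ (a ∷ X) A P R a (subst (ℕ._≤ k) (↭.↭-length (↭.++⁺ˡ A (↭-sym split))) len)
             processing (here refl) (All.all-filter (opposite? a) U)
             (All.tabulate λ u∈ → fresh K (here refl) (↭.∈-resp-↭ split (∈-++⁺ˡ u∈))) ⟩
      θ ^ℚ length A ℚ.* decay ^ℚ length P
        ≤⟨ *-monoʳ-≤ _ (0≤^ (length A) 0≤θ) (drift (length P) (length (X ++ a ∷ A)) small count) ⟩
      θ ^ℚ length A ℚ.* θ                    ≡⟨ ℚ.*-comm (θ ^ℚ length A) θ ⟩
      θ ^ℚ length (a ∷ A)                    ∎
      where
      open ℚ.≤-Reasoning
      P = filter (opposite? a) U
      R = filter (¬? ∘ opposite? a) U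
      split : P ++ R ↭ U
      split = filter-split (opposite? a) U
      -- The n vertices of the class opposite to a are in P or already found.
      count : n ℕ.≤ length P ℕ.+ length (X ++ a ∷ A)
      count = subst₂ ℕ._≤_
        (trans (sym (length-filter-↭ (opposite? a) (X ++ a ∷ A) U
                  (↭-trans (↭-reflexive (List.++-assoc X (a ∷ A) U)) (partition K))))
               (length-opposite n a))
        (ℕ.+-comm (length (X ++ a ∷ A)) (length P))
        (ℕ.+-monoˡ-≤ (length P) (List.length-filter (opposite? a) (X ++ a ∷ A)))
      processing : Known σ (a ∷ X) A (P ++ R)
      processing = record
        { partition = ↭-trans (prep a (↭.++⁺ˡ X (↭.++⁺ˡ A split)))
                        (↭-trans (↭-sym (↭.shift a X (A ++ U))) (partition K))
        ; reached   = λ G x∈ → reached K G (↭.∈-resp-↭ (↭-sym (↭.shift a X A)) x∈)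
        ; fresh     = λ x∈ u∈ → fresh K (there (↭.∈-resp-↭ (↭.++⁺ˡ A split) x∈)) (↭.∈-resp-↭ split u∈)
        }

    scan k σ X A []      R a len K a∈ _            _          =
      subst (E (f ∘ σ) ℚ.≤_) (sym (ℚ.*-identityʳ _)) (explore k σ X A R len K)
    scan k σ X A (u ∷ P) R a len K a∈ (opp ∷ opps) (fr ∷ frs) = begin
      E (f ∘ σ)
        ≡⟨ redraw a u (f ∘ σ) ⟩
      p ℚ.* E (f ∘ σ ∘ setJoined a u true) ℚ.+ (1ℚ ℚ.- p) ℚ.* E (f ∘ σ ∘ setJoined a u false)
        ≤⟨ ℚ.+-mono-≤
             (*-monoʳ-≤ p 0≤p (scan k _ X (u ∷ A) P R a
                (subst (ℕ._≤ k) (↭.↭-length (↭.shift u A (P ++ R))) len)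
                (scan-true a∈ opp K fr) a∈ opps (scan-fresh a∈ K ∈-++⁺ˡ frs)))
             (*-monoʳ-≤ (1ℚ ℚ.- p) (0≤-difference p≤1) (scan k _ X A P (u ∷ R) a
                (subst (ℕ._≤ k) (↭.↭-length (↭.++⁺ˡ A move)) len)
                (scan-false a∈ K (here refl) move) a∈ opps (scan-fresh a∈ K ∈-++⁺ˡ frs))) ⟩
      p ℚ.* (θ ℚ.* Θ ℚ.* D) ℚ.+ (1ℚ ℚ.- p) ℚ.* (Θ ℚ.* D)
        ≡⟨ solve 4 (λ p θ Θ D → p :* (θ :* Θ :* D) :+ (con 1ℚ :- p) :* (Θ :* D) :=
                      Θ :* (((con 1ℚ :- p) :+ p :* θ) :* D)) refl p θ Θ D ⟩
      Θ ℚ.* (decay ℚ.* D) ∎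
      where
      open ℚ.≤-Reasoning
      Θ = θ ^ℚ length A
      D = decay ^ℚ length P
      move : (u ∷ P) ++ R ↭ P ++ u ∷ R
      move = ↭-sym (↭.shift u P R)

    -- Forcing the k + 1 edges in costs a factor p each. Then the whole path hangs together and no
    -- edge leaving it has been revealed, so the exploration starts with k active vertices and
    -- contributes θᵏ.
    shape-bound : ∀ xs z₂ → Unique xs → root ∈ xs → z₂ ∈ xs →
      AllPairs Different (pathEdges (z₂ ∷ xs ∷ʳ root)) →
      All (uncurry Opposite) (pathEdges (z₂ ∷ xs ∷ʳ root)) →
      (∀ {u w} → (u , w) ∈ pathEdges (z₂ ∷ xs ∷ʳ root) → ∀ G → joined G u w ≡ false → f G ≡ 0ℚ) →
      E f ℚ.≤ p ^ℚ ℕ.suc (length xs) ℚ.* θ ^ℚ length xs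
    shape-bound xs z₂ uniq root∈ z₂∈ diff opp f≡0′ = begin
      E f                                      ≡⟨ condition-on-edges D f diff f≡0′ ⟩
      p ^ℚ length D ℚ.* E (f ∘ joinAll D)
        ≤⟨ *-monoʳ-≤ _ (0≤^ (length D) 0≤p) (explore _ (joinAll D) [] xs U ℕ.≤-refl known₀) ⟩
      p ^ℚ length D ℚ.* θ ^ℚ length xs         ≡⟨ cong (λ k → p ^ℚ k ℚ.* θ ^ℚ length xs) size ⟩
      p ^ℚ ℕ.suc (length xs) ℚ.* θ ^ℚ length xs ∎
      where
      open ℚ.≤-Reasoning
      D = pathEdges (z₂ ∷ xs ∷ʳ root)
      size : length D ≡ ℕ.suc (length xs)
      size = trans (length-pathEdges z₂ (xs ∷ʳ root))
                   (trans (List.length-++ xs) (ℕ.+-comm (length xs) 1))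
      U = proj₁ (complement xs (vertices n) uniq λ {x} _ → ∈-vertices x)
      partition₀ : xs ++ U ↭ vertices n
      partition₀ = proj₂ (complement xs (vertices n) uniq λ {x} _ → ∈-vertices x)
      ends : ∀ {u w} → (u , w) ∈ D → u ∈ xs × w ∈ xs
      ends e∈ = let u∈ , w∈ = pathEdges-∈ (z₂ ∷ xs ∷ʳ root) e∈ in inPath u∈ , inPath w∈
        where
        inPath : ∀ {u} → u ∈ z₂ ∷ xs ∷ʳ root → u ∈ xs
        inPath (here refl) = z₂∈
        inPath (there u∈) with ∈-++⁻ xs u∈
        ... | inj₁ u∈′         = u∈′
        ... | inj₂ (here refl) = root∈
      outside : ∀ {u} → u ∈ U → u ∉ xs
      outside u∈U u∈xs = ∈⇒¬unique u∈xs u∈U (unique-resp-↭ (↭-sym partition₀) (vertices-unique n))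
      known₀ : Known (joinAll D) [] xs U
      known₀ = record
        { partition = partition₀
        ; reached   = λ G x∈ → connected-sym (walk⇒connected xs
            (pathEdges-tail (xs ∷ʳ root) (All.map (λ {e} → joined⇒adj _ (proj₁ e) (proj₂ e)) (joined-joinAll D G diff opp))) x∈)
        ; fresh     = λ {x} {u} _ u∈ G → joined-joinAll-other D x u G (All.tabulate λ e∈ →
            (λ { (_ , refl) → outside u∈ (proj₂ (ends e∈)) })
          , (λ { (refl , _) → outside u∈ (proj₁ (ends e∈)) }))
        }

-- The embedding of ℕ

-- Recursive, so that `ι (suc n)` unfolds for the ring solver, unlike the normalised fraction
-- `+ n / 1`.
ι : ℕ → ℚ
ι ℕ.zero    = 0ℚ
ι (ℕ.suc n) = 1ℚ ℚ.+ ι n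

0≤ι : ∀ n → 0ℚ ℚ.≤ ι n
0≤ι ℕ.zero    = ℚ.≤-refl
0≤ι (ℕ.suc n) = 0≤+ (ℚ.nonNegative⁻¹ 1ℚ) (0≤ι n)

ι-+ : ∀ m n → ι (m ℕ.+ n) ≡ ι m ℚ.+ ι n
ι-+ ℕ.zero    n = sym (ℚ.+-identityˡ (ι n))
ι-+ (ℕ.suc m) n = trans (cong (1ℚ ℚ.+_) (ι-+ m n)) (sym (ℚ.+-assoc 1ℚ (ι m) (ι n)))

ι-* : ∀ m n → ι (m ℕ.* n) ≡ ι m ℚ.* ι n
ι-* ℕ.zero    n = sym (ℚ.*-zeroˡ (ι n))
ι-* (ℕ.suc m) n = trans (ι-+ n (m ℕ.* n)) (trans (cong (ι n ℚ.+_) (ι-* m n))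
  (solve 2 (λ m n → n :+ m :* n := (con 1ℚ :+ m) :* n) refl (ι m) (ι n)))

ι-^ : ∀ m k → ι (m ℕ.^ k) ≡ ι m ^ℚ k
ι-^ m ℕ.zero    = refl
ι-^ m (ℕ.suc k) = trans (ι-* m (m ℕ.^ k)) (cong (ι m ℚ.*_) (ι-^ m k))

ι-mono : ∀ {m n} → m ℕ.≤ n → ι m ℚ.≤ ι n
ι-mono {n = n} z≤n   = 0≤ι n
ι-mono (s≤s m≤n)     = ℚ.+-monoʳ-≤ 1ℚ (ι-mono m≤n)

/1-suc : ∀ n → + ℕ.suc n ℚ./ 1 ≡ 1ℚ ℚ.+ (+ n ℚ./ 1)
/1-suc n = ℚ.toℚᵘ-injective (begin
  ℚ.toℚᵘ (+ ℕ.suc n ℚ./ 1)                 ≈⟨ ℚ.toℚᵘ-fromℚᵘ (ℚᵘ.mkℚᵘ (+ ℕ.suc n) 0) ⟩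
  ℚᵘ.mkℚᵘ (+ ℕ.suc n) 0                    ≈⟨ ℚᵘ.*≡* (cong (λ k → (+ 1 ℤ.+ k) ℤ.* (+ 1)) (sym (ℤ.*-identityʳ (+ n)))) ⟩
  ℚᵘ.1ℚᵘ ℚᵘ.+ ℚᵘ.mkℚᵘ (+ n) 0              ≈⟨ ℚᵘ.+-congʳ ℚᵘ.1ℚᵘ (ℚ.toℚᵘ-fromℚᵘ (ℚᵘ.mkℚᵘ (+ n) 0)) ⟨
  ℚᵘ.1ℚᵘ ℚᵘ.+ ℚ.toℚᵘ (+ n ℚ./ 1)           ≈⟨ ℚ.toℚᵘ-homo-+ 1ℚ (+ n ℚ./ 1) ⟨
  ℚ.toℚᵘ (1ℚ ℚ.+ (+ n ℚ./ 1))              ∎)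
  where open ℚᵘ.≃-Reasoning

/1≡ι : ∀ n → + n ℚ./ 1 ≡ ι n
/1≡ι ℕ.zero    = refl
/1≡ι (ℕ.suc n) = trans (/1-suc n) (cong (1ℚ ℚ.+_) (/1≡ι n))

ι*1/ : ∀ n .{{_ : NonZero n}} → ι n ℚ.* (+ 1 ℚ./ n) ≡ 1ℚ
ι*1/ n@(ℕ.suc m) = trans (cong (ℚ._* (+ 1 ℚ./ n)) (sym (/1≡ι n))) (ℚ.toℚᵘ-injective (begin
  ℚ.toℚᵘ ((+ n ℚ./ 1) ℚ.* (+ 1 ℚ./ n))          ≈⟨ ℚ.toℚᵘ-homo-* (+ n ℚ./ 1) (+ 1 ℚ./ n) ⟩
  ℚ.toℚᵘ (+ n ℚ./ 1) ℚᵘ.* ℚ.toℚᵘ (+ 1 ℚ./ n)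
    ≈⟨ ℚᵘ.*-cong (ℚ.toℚᵘ-fromℚᵘ (ℚᵘ.mkℚᵘ (+ n) 0)) (ℚ.toℚᵘ-fromℚᵘ (ℚᵘ.mkℚᵘ (+ 1) m)) ⟩
  ℚᵘ.mkℚᵘ (+ n) 0 ℚᵘ.* ℚᵘ.mkℚᵘ (+ 1) m          ≈⟨ ℚᵘ.*≡* (cong (λ k → + ℕ.suc k) (arith m)) ⟩
  ℚᵘ.1ℚᵘ ∎))
  where
  open ℚᵘ.≃-Reasoning
  arith : ∀ m → m ℕ.* 1 ℕ.* 1 ≡ m ℕ.+ 0 ℕ.+ 0
  arith m = trans (ℕ.*-identityʳ (m ℕ.* 1)) (trans (ℕ.*-identityʳ m)
    (sym (trans (ℕ.+-identityʳ (m ℕ.+ 0)) (ℕ.+-identityʳ m))))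

sum-bounded : ∀ {A : Set} {f : A → ℚ} c xs → (∀ x → x ∈ xs → f x ℚ.≤ c) → sum f xs ℚ.≤ ι (length xs) ℚ.* c
sum-bounded c []       f≤c = ℚ.≤-reflexive (sym (ℚ.*-zeroˡ c))
sum-bounded c (x ∷ xs) f≤c = ℚ.≤-trans
  (ℚ.+-mono-≤ (f≤c x (here refl)) (sum-bounded c xs λ y y∈ → f≤c y (there y∈)))
  (ℚ.≤-reflexive (solve 2 (λ c k → c :+ k :* c := (con 1ℚ :+ k) :* c) refl c (ι (length xs))))

-- Elementary inequalities

-- The partial sums telescope: (1 - ρ)³ k² ρᵏ = h k - h (k + 1) for
-- h k = ρᵏ ((1 - ρ)² k² + 2 ρ (1 - ρ) k + ρ + ρ²).
sum-k²ρᵏ : ∀ {ρ} → 0ℚ ℚ.≤ ρ → ρ ℚ.≤ 1ℚ → ∀ K →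
  (1ℚ ℚ.- ρ) ^ℚ 3 ℚ.* sum (λ k → ι k ℚ.* ι k ℚ.* ρ ^ℚ k) (List.downFrom K) ℚ.≤ ι 2
sum-k²ρᵏ {ρ} 0≤ρ ρ≤1 K = begin
  (1ℚ ℚ.- ρ) ^ℚ 3 ℚ.* S K       ≤⟨ ≤-from-difference (h K) 0≤h (telescope K) ⟩
  ρ ℚ.+ ρ ℚ.* ρ                 ≤⟨ ℚ.+-mono-≤ ρ≤1 (*-mono-≤ 0≤ρ (ℚ.nonNegative⁻¹ 1ℚ) ρ≤1 ρ≤1) ⟩
  ι 2                           ∎
  where
  open ℚ.≤-Reasoning
  S : ℕ → ℚ
  S K = sum (λ k → ι k ℚ.* ι k ℚ.* ρ ^ℚ k) (List.downFrom K)
  q = 1ℚ ℚ.- ρ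
  0≤q = 0≤-difference ρ≤1
  h : ℕ → ℚ
  h k = ρ ^ℚ k ℚ.* (q ℚ.* q ℚ.* (ι k ℚ.* ι k) ℚ.+ ι 2 ℚ.* ρ ℚ.* q ℚ.* ι k ℚ.+ (ρ ℚ.+ ρ ℚ.* ρ))
  0≤h : 0ℚ ℚ.≤ h K
  0≤h = 0≤* (0≤^ K 0≤ρ) (0≤+ (0≤+ (0≤* (0≤* 0≤q 0≤q) (0≤* (0≤ι K) (0≤ι K)))
    (0≤* (0≤* (0≤* (0≤ι 2) 0≤ρ) 0≤q) (0≤ι K))) (0≤+ 0≤ρ (0≤* 0≤ρ 0≤ρ)))
  telescope : ∀ K → q ^ℚ 3 ℚ.* S K ℚ.+ h K ≡ ρ ℚ.+ ρ ℚ.* ρ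
  telescope ℕ.zero = solve 1 (λ ρ → let q = con 1ℚ :- ρ in
    q :* (q :* (q :* con 1ℚ)) :* con 0ℚ :+
      con 1ℚ :* (q :* q :* (con 0ℚ :* con 0ℚ) :+ con (ι 2) :* ρ :* q :* con 0ℚ :+ (ρ :+ ρ :* ρ))
    := ρ :+ ρ :* ρ) refl ρ
  telescope (ℕ.suc K) = trans (solve 4 (λ ρ k S r → let q = con 1ℚ :- ρ in
    q :* (q :* (q :* con 1ℚ)) :* (k :* k :* r :+ S) :+
      ρ :* r :* (q :* q :* ((con 1ℚ :+ k) :* (con 1ℚ :+ k))
                 :+ con (ι 2) :* ρ :* q :* (con 1ℚ :+ k) :+ (ρ :+ ρ :* ρ))
    := q :* (q :* (q :* con 1ℚ)) :* S :+
      r :* (q :* q :* (k :* k) :+ con (ι 2) :* ρ :* q :* k :+ (ρ :+ ρ :* ρ)))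
    refl ρ (ι K) (S K) (ρ ^ℚ K)) (telescope K)

-- The bracket is twice the second-order truncation of (1 + u)ʳ, and (1 - u)ʳ (1 + u)ʳ ≤ 1. The
-- quadratic term matters: in `Survival`, the bound with 1 + r u alone would admit θ = 1 - x only
-- for x up to about 3 t, while ρ < 1 asks for x above about 4 t.
second-order-bernoulli : ∀ {u} → 0ℚ ℚ.≤ u → u ℚ.≤ 1ℚ → ∀ r →
  (1ℚ ℚ.- u) ^ℚ r ℚ.* (ι 2 ℚ.+ ι 2 ℚ.* (ι r ℚ.* u) ℚ.+ ι r ℚ.* u ℚ.* (ι r ℚ.* u ℚ.- u)) ℚ.≤ ι 2
second-order-bernoulli {u} 0≤u u≤1 ℕ.zero = ℚ.≤-reflexive (solve 1 (λ u →
  con 1ℚ :* (con (ι 2) :+ con (ι 2) :* (con 0ℚ :* u) :+ con 0ℚ :* u :* (con 0ℚ :* u :- u)) := con (ι 2))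
  refl u)
second-order-bernoulli {u} 0≤u u≤1 (ℕ.suc r) = ℚ.≤-trans
  (≤-from-difference (Q ℚ.* (u ℚ.* u ℚ.* (ι 2 ℚ.+ (R ℚ.* R ℚ.+ R) ℚ.* u)))
    (0≤* (0≤^ r (0≤-difference u≤1)) (0≤* (0≤* 0≤u 0≤u)
      (0≤+ (0≤ι 2) (0≤* (0≤+ (0≤* (0≤ι r) (0≤ι r)) (0≤ι r)) 0≤u))))
    (solve 3 (λ u R Q → let S = con 1ℚ :+ R in
      (con 1ℚ :- u) :* Q :* (con (ι 2) :+ con (ι 2) :* (S :* u) :+ S :* u :* (S :* u :- u))
        :+ Q :* (u :* u :* (con (ι 2) :+ (R :* R :+ R) :* u))
      := Q :* (con (ι 2) :+ con (ι 2) :* (R :* u) :+ R :* u :* (R :* u :- u))) refl u R Q))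
  (second-order-bernoulli 0≤u u≤1 r)
  where
  R = ι r
  Q = (1ℚ ℚ.- u) ^ℚ r

^-mono-≤ : ∀ {a b} → 0ℚ ℚ.≤ a → a ℚ.≤ b → ∀ k → a ^ℚ k ℚ.≤ b ^ℚ k
^-mono-≤ 0≤a a≤b ℕ.zero    = ℚ.≤-refl
^-mono-≤ {a} {b} 0≤a a≤b (ℕ.suc k) = *-mono-≤ 0≤a (0≤^ k (ℚ.≤-trans 0≤a a≤b)) a≤b (^-mono-≤ 0≤a a≤b k)

^3-cancel-≤ : ∀ {a b} → 0ℚ ℚ.≤ b → a ^ℚ 3 ℚ.≤ b ^ℚ 3 → a ℚ.≤ b
^3-cancel-≤ {a} {b} 0≤b a³≤b³ with a ℚ.≤? b
... | yes a≤b = a≤b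
... | no  a≰b = contradiction (ℚ.≤-<-trans a³≤b³ b³<a³) (ℚ.<-irrefl refl)
  where
  open ℚ.≤-Reasoning
  b<a = ℚ.≰⇒> a≰b
  0<a = ℚ.≤-<-trans 0≤b b<a
  0≤a = ℚ.<⇒≤ 0<a
  0<a² : 0ℚ ℚ.< a ^ℚ 2
  0<a² = ℚ.positive⁻¹ (a ^ℚ 2)
    {{ℚ.pos*pos⇒pos a {{ℚ.positive 0<a}} (a ℚ.* 1ℚ) {{ℚ.pos*pos⇒pos a {{ℚ.positive 0<a}} 1ℚ}}}}
  b³<a³ : b ^ℚ 3 ℚ.< a ^ℚ 3
  b³<a³ = begin-strict
    b ℚ.* b ^ℚ 2  ≤⟨ *-monoʳ-≤ b 0≤b (^-mono-≤ 0≤b (ℚ.<⇒≤ b<a) 2) ⟩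
    b ℚ.* a ^ℚ 2  <⟨ ℚ.*-monoˡ-<-pos (a ^ℚ 2) {{ℚ.positive 0<a²}} b<a ⟩
    a ℚ.* a ^ℚ 2  ∎

-- With ε = 4 t and θ = 1 - 5 t: as long as S ≤ n ^ (2/3) vertices have been
-- found, the r ≥ n - S remaining ones make θ ^ (number of active vertices) a
-- supermartingale.
module Survival {t p N : ℚ} (0≤t : 0ℚ ℚ.≤ t) (400t≤1 : ι 400 ℚ.* t ℚ.≤ 1ℚ)
  (pN≡ : p ℚ.* N ≡ 1ℚ ℚ.+ ι 4 ℚ.* t) (0≤p : 0ℚ ℚ.≤ p) (p≤1 : p ℚ.≤ 1ℚ) (0≤N : 0ℚ ℚ.≤ N)
  (large : ι 1000 ℚ.≤ (ι 4 ℚ.* t) ^ℚ 3 ℚ.* N)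
  (r : ℕ) {S : ℚ} (0≤S : 0ℚ ℚ.≤ S) (S³≤N² : S ^ℚ 3 ℚ.≤ N ^ℚ 2) (N≤r+S : N ℚ.≤ ι r ℚ.+ S) where

  open ℚ.≤-Reasoning

  private
    R = ι r
    x = ι 5 ℚ.* t
    u = p ℚ.* x
    y = R ℚ.* u
    θ = 1ℚ ℚ.- x

  multiple≤1 : ∀ k → k ℕ.≤ 400 → ι k ℚ.* t ℚ.≤ 1ℚ
  multiple≤1 k k≤ = ℚ.≤-trans (*-monoˡ-≤ t 0≤t (ι-mono k≤)) 400t≤1

  0≤x : 0ℚ ℚ.≤ x
  0≤x = 0≤* (0≤ι 5) 0≤t

  0≤u : 0ℚ ℚ.≤ u
  0≤u = 0≤* 0≤p 0≤x

  x≤1 : x ℚ.≤ 1ℚ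
  x≤1 = multiple≤1 5 (ℕ.m≤m+n 5 395)

  u≤1 : u ℚ.≤ 1ℚ
  u≤1 = *-mono-≤ 0≤p (ℚ.nonNegative⁻¹ 1ℚ) p≤1 x≤1

  -- Compare cubes: S³ ≤ N² and ε³ N ≥ 1000 give (10 S)³ ≤ (ε N)³. This is where the exponent 2/3
  -- meets the growth of ε³ n, and 1000 is 10³.
  10S≤4tN : ι 10 ℚ.* S ℚ.≤ ι 4 ℚ.* t ℚ.* N
  10S≤4tN = ^3-cancel-≤ (0≤* (0≤* (0≤ι 4) 0≤t) 0≤N) (begin
    (ι 10 ℚ.* S) ^ℚ 3
      ≡⟨ solve 1 (λ S → let T = con (ι 10) :* S in T :* (T :* (T :* con 1ℚ)) :=
           con (ι 1000) :* (S :* (S :* (S :* con 1ℚ)))) refl S ⟩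
    ι 1000 ℚ.* S ^ℚ 3
      ≤⟨ *-mono-≤ (0≤ι 1000) (0≤^ 2 0≤N) large S³≤N² ⟩
    (ι 4 ℚ.* t) ^ℚ 3 ℚ.* N ℚ.* N ^ℚ 2
      ≡⟨ solve 2 (λ e N → e :* (e :* (e :* con 1ℚ)) :* N :* (N :* (N :* con 1ℚ)) :=
           (e :* N) :* ((e :* N) :* ((e :* N) :* con 1ℚ))) refl (ι 4 ℚ.* t) N ⟩
    (ι 4 ℚ.* t ℚ.* N) ^ℚ 3 ∎)

  -- As p is of order 1 / N, it is negligible against ε. It has to be, because the quadratic term of
  -- the Bernoulli bound contains r - 1 in place of r.
  10p≤5t : ι 10 ℚ.* p ℚ.≤ ι 5 ℚ.* t
  10p≤5t = ℚ.*-cancelˡ-≤-pos (ι 100) (begin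
    ι 100 ℚ.* (ι 10 ℚ.* p)                ≡⟨ solve 1 (λ p → con (ι 100) :* (con (ι 10) :* p) := p :* con (ι 1000)) refl p ⟩
    p ℚ.* ι 1000                          ≤⟨ *-monoʳ-≤ p 0≤p large ⟩
    p ℚ.* ((ι 4 ℚ.* t) ^ℚ 3 ℚ.* N)        ≡⟨ solve 3 (λ p e N → p :* (e :* N) := e :* (p :* N)) refl p ((ι 4 ℚ.* t) ^ℚ 3) N ⟩
    (ι 4 ℚ.* t) ^ℚ 3 ℚ.* (p ℚ.* N)        ≡⟨ cong ((ι 4 ℚ.* t) ^ℚ 3 ℚ.*_) pN≡ ⟩
    (ι 4 ℚ.* t) ^ℚ 3 ℚ.* (1ℚ ℚ.+ ι 4 ℚ.* t)
      ≡⟨ solve 1 (λ e → e :* (e :* (e :* con 1ℚ)) :* (con 1ℚ :+ e) := e :* (e :* e :* (con 1ℚ :+ e))) refl (ι 4 ℚ.* t) ⟩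
    ι 4 ℚ.* t ℚ.* (ι 4 ℚ.* t ℚ.* (ι 4 ℚ.* t) ℚ.* (1ℚ ℚ.+ ι 4 ℚ.* t))
      ≤⟨ *-monoʳ-≤ (ι 4 ℚ.* t) 0≤4t (*-mono-≤ (0≤* 0≤4t 0≤4t) (0≤ι 2)
           (*-mono-≤ 0≤4t (ℚ.nonNegative⁻¹ 1ℚ) 4t≤1 4t≤1) (ℚ.+-monoʳ-≤ 1ℚ 4t≤1)) ⟩
    ι 4 ℚ.* t ℚ.* ι 2                     ≡⟨ solve 1 (λ t → con (ι 4) :* t :* con (ι 2) := con (ι 8) :* t) refl t ⟩
    ι 8 ℚ.* t                             ≤⟨ *-monoˡ-≤ t 0≤t (ι-mono (ℕ.m≤m+n 8 492)) ⟩
    ι 500 ℚ.* t                           ≡⟨ solve 1 (λ t → con (ι 500) :* t := con (ι 100) :* (con (ι 5) :* t)) refl t ⟩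
    ι 100 ℚ.* (ι 5 ℚ.* t)                 ∎)
    where
    0≤4t : 0ℚ ℚ.≤ ι 4 ℚ.* t
    0≤4t = 0≤* (0≤ι 4) 0≤t
    4t≤1 : ι 4 ℚ.* t ℚ.≤ 1ℚ
    4t≤1 = multiple≤1 4 (ℕ.m≤m+n 4 396)

  -- Of the drift ε = 4 t the found vertices take about 4 t / 10 and p takes at most t / 2, which
  -- leaves 3 t.
  mean : 1ℚ ℚ.+ ι 3 ℚ.* t ℚ.+ p ℚ.≤ R ℚ.* p
  mean = ℚ.*-cancelˡ-≤-pos (ι 10) (begin
    ι 10 ℚ.* (1ℚ ℚ.+ ι 3 ℚ.* t ℚ.+ p)
      ≡⟨ solve 2 (λ t p → con (ι 10) :* (con 1ℚ :+ con (ι 3) :* t :+ p) :=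
           con (ι 10) :+ con (ι 30) :* t :+ con (ι 10) :* p) refl t p ⟩
    ι 10 ℚ.+ ι 30 ℚ.* t ℚ.+ ι 10 ℚ.* p
      ≤⟨ ℚ.+-monoʳ-≤ (ι 10 ℚ.+ ι 30 ℚ.* t) 10p≤5t ⟩
    ι 10 ℚ.+ ι 30 ℚ.* t ℚ.+ ι 5 ℚ.* t
      ≤⟨ ≤-from-difference (t ℚ.* (1ℚ ℚ.- ι 16 ℚ.* t)) (0≤* 0≤t (0≤-difference (multiple≤1 16 (ℕ.m≤m+n 16 384))))
           (solve 1 (λ t → con (ι 10) :+ con (ι 30) :* t :+ con (ι 5) :* t :+ t :* (con 1ℚ :- con (ι 16) :* t) :=
              con (ι 10) :* (con 1ℚ :+ con (ι 4) :* t) :- con (ι 4) :* t :* (con 1ℚ :+ con (ι 4) :* t)) refl t) ⟩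
    ι 10 ℚ.* (1ℚ ℚ.+ ι 4 ℚ.* t) ℚ.- ι 4 ℚ.* t ℚ.* (1ℚ ℚ.+ ι 4 ℚ.* t)
      ≡⟨ cong (λ e → ι 10 ℚ.* e ℚ.- ι 4 ℚ.* t ℚ.* e) pN≡ ⟨
    ι 10 ℚ.* (p ℚ.* N) ℚ.- ι 4 ℚ.* t ℚ.* (p ℚ.* N)
      ≤⟨ ≤-from-difference (p ℚ.* (ι 4 ℚ.* t ℚ.* N ℚ.- ι 10 ℚ.* S)) (0≤* 0≤p (0≤-difference 10S≤4tN))
           (solve 4 (λ t p N S → con (ι 10) :* (p :* N) :- con (ι 4) :* t :* (p :* N)
              :+ p :* (con (ι 4) :* t :* N :- con (ι 10) :* S) := con (ι 10) :* (p :* N) :- con (ι 10) :* p :* S) refl t p N S) ⟩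
    ι 10 ℚ.* (p ℚ.* N) ℚ.- ι 10 ℚ.* p ℚ.* S
      ≤⟨ ≤-from-difference (ι 10 ℚ.* p ℚ.* (R ℚ.+ S ℚ.- N)) (0≤* (0≤* (0≤ι 10) 0≤p) (0≤-difference N≤r+S))
           (solve 4 (λ R p N S → con (ι 10) :* (p :* N) :- con (ι 10) :* p :* S
              :+ con (ι 10) :* p :* (R :+ S :- N) := con (ι 10) :* (R :* p)) refl R p N S) ⟩
    ι 10 ℚ.* (R ℚ.* p) ∎)

  y-large : x ℚ.* (1ℚ ℚ.+ ι 3 ℚ.* t) ℚ.≤ y ℚ.- u
  y-large = begin
    x ℚ.* (1ℚ ℚ.+ ι 3 ℚ.* t)              ≡⟨ solve 3 (λ x t p → x :* (con 1ℚ :+ con (ι 3) :* t) :=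
                                               x :* (con 1ℚ :+ con (ι 3) :* t :+ p) :- p :* x) refl x t p ⟩
    x ℚ.* (1ℚ ℚ.+ ι 3 ℚ.* t ℚ.+ p) ℚ.- u  ≤⟨ ℚ.+-monoˡ-≤ (ℚ.- u) (*-monoʳ-≤ x 0≤x mean) ⟩
    x ℚ.* (R ℚ.* p) ℚ.- u                 ≡⟨ solve 3 (λ x R p → x :* (R :* p) :- p :* x := R :* (p :* x) :- p :* x) refl x R p ⟩
    y ℚ.- u                               ∎

  x≤y-u : x ℚ.≤ y ℚ.- u
  x≤y-u = ℚ.≤-trans (≤-from-difference (x ℚ.* (ι 3 ℚ.* t)) (0≤* 0≤x (0≤* (0≤ι 3) 0≤t))
    (solve 2 (λ x t → x :+ x :* (con (ι 3) :* t) := x :* (con 1ℚ :+ con (ι 3) :* t)) refl x t)) y-large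

  y-u≤y : y ℚ.- u ℚ.≤ y
  y-u≤y = ≤-from-difference u 0≤u (solve 2 (λ y u → y :- u :+ u := y) refl y u)

  Q : ℚ
  Q = ι 2 ℚ.+ ι 2 ℚ.* y ℚ.+ y ℚ.* (y ℚ.- u)

  Q-large : ι 2 ℚ.+ ι 2 ℚ.* (x ℚ.* (1ℚ ℚ.+ ι 3 ℚ.* t)) ℚ.+ x ℚ.* x ℚ.≤ Q
  Q-large = ℚ.+-mono-≤ (ℚ.+-monoʳ-≤ (ι 2) (*-monoʳ-≤ (ι 2) (0≤ι 2) (ℚ.≤-trans y-large y-u≤y)))
    (*-mono-≤ 0≤x (ℚ.≤-trans 0≤x x≤y-u) (ℚ.≤-trans x≤y-u y-u≤y) x≤y-u)

  -- The linear terms of (1 - x) (2 + 2 x (1 + 3 t) + x²) cancel, and the quadratic ones leave x (6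
  -- t - x), which is 5 t² for x = 5 t. The factor 1 - 55 t absorbs the cubic term.
  2≤θQ : ι 2 ℚ.≤ θ ℚ.* Q
  2≤θQ = ℚ.≤-trans (≤-from-difference (ι 5 ℚ.* (t ℚ.* t) ℚ.* (1ℚ ℚ.- ι 55 ℚ.* t))
      (0≤* (0≤* (0≤ι 5) (0≤* 0≤t 0≤t)) (0≤-difference (multiple≤1 55 (ℕ.m≤m+n 55 345))))
      (solve 1 (λ t → let x = con (ι 5) :* t in
        con (ι 2) :+ con (ι 5) :* (t :* t) :* (con 1ℚ :- con (ι 55) :* t) :=
        (con 1ℚ :- x) :* (con (ι 2) :+ con (ι 2) :* (x :* (con 1ℚ :+ con (ι 3) :* t)) :+ x :* x)) refl t))
    (*-monoʳ-≤ θ (0≤-difference x≤1) Q-large)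

  0<Q : 0ℚ ℚ.< Q
  0<Q = ℚ.<-≤-trans (ℚ.positive⁻¹ (ι 2)) (begin
    ι 2                       ≡⟨ solve 0 (con (ι 2) := con (ι 2) :+ con 0ℚ :+ con 0ℚ) refl ⟩
    ι 2 ℚ.+ 0ℚ ℚ.+ 0ℚ         ≤⟨ ℚ.+-mono-≤ (ℚ.+-monoʳ-≤ (ι 2) (0≤* (0≤ι 2) 0≤y)) (0≤* 0≤y (ℚ.≤-trans 0≤x x≤y-u)) ⟩
    Q                         ∎)
    where
    0≤y : 0ℚ ℚ.≤ y
    0≤y = 0≤* (0≤ι r) 0≤u

  survival-drift : ((1ℚ ℚ.- p) ℚ.+ p ℚ.* (1ℚ ℚ.- ι 5 ℚ.* t)) ^ℚ r ℚ.≤ 1ℚ ℚ.- ι 5 ℚ.* t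
  survival-drift = ℚ.*-cancelʳ-≤-pos Q {{ℚ.positive 0<Q}} (begin
    ((1ℚ ℚ.- p) ℚ.+ p ℚ.* θ) ^ℚ r ℚ.* Q
      ≡⟨ cong (λ d → d ^ℚ r ℚ.* Q)
           (solve 2 (λ p x → (con 1ℚ :- p) :+ p :* (con 1ℚ :- x) := con 1ℚ :- p :* x) refl p x) ⟩
    (1ℚ ℚ.- u) ^ℚ r ℚ.* Q   ≤⟨ second-order-bernoulli 0≤u u≤1 r ⟩
    ι 2                     ≤⟨ 2≤θQ ⟩
    θ ℚ.* Q                 ∎)

-- Paths in the complete bipartite graph

side : ∀ {n} → Vertex n → Bool
side (inj₁ _) = true
side (inj₂ _) = false

inClass : ∀ {n} → Bool → Fin n → Vertex n
inClass true  = inj₁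
inClass false = inj₂

alternating : ∀ n → Bool → ℕ → List (List (Vertex n))
alternating n s ℕ.zero    = [] ∷ []
alternating n s (ℕ.suc k) = cartesianProductWith _∷_ (map (inClass s) (allFin n)) (alternating n (not s) k)

∈-alternating : ∀ {n} (v : Vertex n) xs → All (uncurry Opposite) (pathEdges (v ∷ xs)) →
  v ∷ xs ∈ alternating n (side v) (ℕ.suc (length xs))
∈-alternating {n} v xs opp = ∈-cartesianProductWith⁺ _∷_ (v∈ v) (rest xs opp)
  where
  v∈ : ∀ v → v ∈ map (inClass (side v)) (allFin n)
  v∈ (inj₁ i) = ∈-map⁺ inj₁ (∈-allFin i)
  v∈ (inj₂ j) = ∈-map⁺ inj₂ (∈-allFin j)
  switch : ∀ {w} → Opposite v w → side w ≡ not (side v)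
  switch lr = refl
  switch rl = refl
  rest : ∀ xs → All (uncurry Opposite) (pathEdges (v ∷ xs)) → xs ∈ alternating n (not (side v)) (length xs)
  rest []       _           = here refl
  rest (w ∷ xs) (vw ∷ opps) =
    subst (λ s → w ∷ xs ∈ alternating n s (ℕ.suc (length xs))) (switch vw) (∈-alternating w xs opps)

length-cartesianProductWith : ∀ {A B C : Set} (f : A → B → C) xs ys →
  length (cartesianProductWith f xs ys) ≡ length xs ℕ.* length ys
length-cartesianProductWith f []       ys = refl
length-cartesianProductWith f (x ∷ xs) ys = trans (List.length-++ (map (f x) ys))
  (cong₂ ℕ._+_ (List.length-map (f x) ys) (length-cartesianProductWith f xs ys))

length-alternating : ∀ n s k → length (alternating n s k) ≡ n ℕ.^ k
length-alternating n s ℕ.zero    = refl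
length-alternating n s (ℕ.suc k) = trans
  (length-cartesianProductWith _∷_ (map (inClass s) (allFin n)) (alternating n (not s) k))
  (cong₂ ℕ._*_ (length-map-allFin (inClass {n} s))
               (length-alternating n (not s) k))

alternating-length : ∀ n s k {xs} → xs ∈ alternating n s k → length xs ≡ k
alternating-length n s ℕ.zero    (here refl) = refl
alternating-length n s (ℕ.suc k) xs∈
  with ∈-cartesianProductWith⁻ _∷_ (map (inClass s) (allFin n)) (alternating n (not s) k) xs∈
... | _ , _ , _ , ys∈ , refl = cong ℕ.suc (alternating-length n (not s) k ys∈)

paths : ∀ n → ℕ → List (List (Vertex n))
paths n k = alternating n true k ++ alternating n false k

∈-paths : ∀ {n} (xs : List (Vertex n)) → All (uncurry Opposite) (pathEdges xs) → xs ∈ paths n (length xs)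
∈-paths []              _   = here refl
∈-paths (v@(inj₁ _) ∷ xs) opp = ∈-++⁺ˡ (∈-alternating v xs opp)
∈-paths {n} (v@(inj₂ _) ∷ xs) opp = ∈-++⁺ʳ (alternating n true (ℕ.suc (length xs))) (∈-alternating v xs opp)

paths-length : ∀ n k {xs} → xs ∈ paths n k → length xs ≡ k
paths-length n k xs∈ with ∈-++⁻ (alternating n true k) xs∈
... | inj₁ xs∈′ = alternating-length n true k xs∈′
... | inj₂ xs∈′ = alternating-length n false k xs∈′

ι-length-paths : ∀ n k → ι (length (paths n k)) ≡ ι 2 ℚ.* ι n ^ℚ k
ι-length-paths n k = begin
  ι (length (paths n k))             ≡⟨ cong ι (List.length-++ (alternating n true k)) ⟩
  ι (length (alternating n true k) ℕ.+ length (alternating n false k))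
    ≡⟨ cong₂ (λ a b → ι (a ℕ.+ b)) (length-alternating n true k) (length-alternating n false k) ⟩
  ι (n ℕ.^ k ℕ.+ n ℕ.^ k)            ≡⟨ ι-+ (n ℕ.^ k) (n ℕ.^ k) ⟩
  ι (n ℕ.^ k) ℚ.+ ι (n ℕ.^ k)        ≡⟨ solve 1 (λ a → a :+ a := con (ι 2) :* a) refl (ι (n ℕ.^ k)) ⟩
  ι 2 ℚ.* ι (n ℕ.^ k)                ≡⟨ cong (ι 2 ℚ.*_) (ι-^ n k) ⟩
  ι 2 ℚ.* ι n ^ℚ k                   ∎
  where open ≡-Reasoning

order-connected : ∀ {n} (G : BipGraph n) {u w} → Connected G u w → order G u ≡ order G w
order-connected {n} G uw = cong length (List.filter-≐ (connected? G _) (connected? G _)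
  ((connected-sym uw ◅◅_) , (uw ◅◅_)) (vertices n))

different? : ∀ {n} (e f : Vertex n × Vertex n) → Dec (Different e f)
different? (u , w) (x , y) = ¬? ((u ≟ⱽ x) ×-dec (w ≟ⱽ y)) ×-dec ¬? ((u ≟ⱽ y) ×-dec (w ≟ⱽ x))

-- The first moment bound

module FirstMoment {n : ℕ} {p : ℚ} (0≤p : 0ℚ ℚ.≤ p) (p≤1 : p ℚ.≤ 1ℚ)
  {Small : ℕ → Set} (small? : Decidable Small)
  (small-↓ : ∀ {s t} → s ℕ.≤ t → Small t → Small s)
  {θ : ℚ} (0≤θ : 0ℚ ℚ.≤ θ)
  (drift : ∀ r s → Small s → n ℕ.≤ r ℕ.+ s → ((1ℚ ℚ.- p) ℚ.+ p ℚ.* θ) ^ℚ r ℚ.≤ θ) where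

  open Exploration {n} 0≤p p≤1
  open IsExpectation (Gnp-isExpectation n 0≤p p≤1)

  private
    V = Vertex n

  -- The conditions on a candidate that do not involve G. They are tested inside the indicator, so
  -- that the sum may run over all vertex lists in `paths`.
  Admissible : List V → V → V → Set
  Admissible xs z₁ z₂ =
    Unique xs × AllPairs Different D × All (uncurry Opposite) D
    where D = pathEdges (z₂ ∷ xs ∷ʳ z₁)

  Present : List V → V → V → BipGraph n → Set
  Present xs z₁ z₂ G = All (uncurry (Adj G)) (pathEdges (z₂ ∷ xs ∷ʳ z₁)) × Small (order G z₁)

  admissible? : ∀ xs z₁ z₂ → Dec (Admissible xs z₁ z₂)
  admissible? xs z₁ z₂ = unique? xs ×-dec (AllPairs.allPairs? different? D ×-dec All.all? (uncurry opposite?) D)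
    where D = pathEdges (z₂ ∷ xs ∷ʳ z₁)

  present? : ∀ xs z₁ z₂ G → Dec (Present xs z₁ z₂ G)
  present? xs z₁ z₂ G = All.all? (uncurry (adj? G)) (pathEdges (z₂ ∷ xs ∷ʳ z₁)) ×-dec small? (order G z₁)

  indicator : List V → V → V → BipGraph n → ℚ
  indicator xs z₁ z₂ G = 𝟙 (admissible? xs z₁ z₂ ×-dec present? xs z₁ z₂ G)

  indicator-bound : ∀ xs z₁ z₂ → z₁ ∈ xs → z₂ ∈ xs →
    E (indicator xs z₁ z₂) ℚ.≤ p ^ℚ ℕ.suc (length xs) ℚ.* θ ^ℚ length xs
  indicator-bound xs z₁ z₂ z₁∈ z₂∈ = byCases (admissible? xs z₁ z₂)
    where
    i? = λ G → admissible? xs z₁ z₂ ×-dec present? xs z₁ z₂ G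
    byCases : Dec (Admissible xs z₁ z₂) → E (indicator xs z₁ z₂) ℚ.≤ p ^ℚ ℕ.suc (length xs) ℚ.* θ ^ℚ length xs
    byCases (yes (uniq , diff , opp)) =
      shape-bound small? small-↓ 0≤θ drift z₁ (indicator xs z₁ z₂) (λ G → 𝟙≤1 (i? G))
        (λ G ¬small → 𝟙-no (i? G) λ (_ , _ , small) → ¬small small)
        xs z₂ uniq z₁∈ z₂∈ diff opp
        (λ e∈ G eq → 𝟙-no (i? G) λ (_ , adj , _) → adj⇒joined (All.lookup adj e∈) eq)
    byCases (no ¬adm) = subst (ℚ._≤ p ^ℚ ℕ.suc (length xs) ℚ.* θ ^ℚ length xs)
      (sym (trans (μ-cong λ G → 𝟙-no (i? G) (¬adm ∘ proj₁)) (unit 0ℚ)))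
      (0≤* (0≤^ (ℕ.suc (length xs)) 0≤p) (0≤^ (length xs) 0≤θ))

  -- From 0 to 2 n, as a path has at most 2 n vertices.
  sizes : List ℕ
  sizes = List.downFrom (ℕ.suc (n ℕ.+ n))

  ends : List V → BipGraph n → ℚ
  ends xs G = sum (λ z₁ → sum (λ z₂ → indicator xs z₁ z₂ G) xs) xs

  count : BipGraph n → ℚ
  count G = sum (λ k → sum (λ xs → ends xs G) (paths n k)) sizes

  0≤ends : ∀ G xs → 0ℚ ℚ.≤ ends xs G
  0≤ends G xs = sum-nonNeg (λ z₁ → sum-nonNeg (λ z₂ → 0≤𝟙 (admissible? xs z₁ z₂ ×-dec present? xs z₁ z₂ G)) xs) xs

  0≤count : ∀ G → 0ℚ ℚ.≤ count G
  0≤count G = sum-nonNeg (λ k → sum-nonNeg (0≤ends G) (paths n k)) sizes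

  1≤count : ∀ G v → Small (order G v) → ComplexComponent G v → 1ℚ ℚ.≤ count G
  1≤count G v small complex = begin
    1ℚ                        ≡⟨ 𝟙-yes (i? z₁ z₂) ((unique , different , opp) , present , small′) ⟨
    𝟙 (i? z₁ z₂)              ≤⟨ term≤sum (λ z → 0≤𝟙 (i? z₁ z)) z₂∈ ⟩
    sum (λ z → 𝟙 (i? z₁ z)) path
      ≤⟨ term≤sum {f = λ z′ → sum (λ z → 𝟙 (i? z′ z)) path} (λ z′ → sum-nonNeg (λ z → 0≤𝟙 (i? z′ z)) path) z₁∈ ⟩
    ends path G               ≤⟨ term≤sum (0≤ends G) (∈-paths path (pathEdges-init path (pathEdges-tail (path ∷ʳ z₁) opp))) ⟩
    sum (λ xs → ends xs G) (paths n (length path))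
      ≤⟨ term≤sum {f = λ k → sum (λ xs → ends xs G) (paths n k)} (λ k → sum-nonNeg (0≤ends G) (paths n k))
           (∈-downFrom⁺ (s≤s (unique⇒length≤ unique))) ⟩
    count G                   ∎
    where
    open ℚ.≤-Reasoning
    open Shape (complex⇒shape G complex)
    i? : ∀ z z′ → Dec _
    i? z z′ = admissible? path z z′ ×-dec present? path z z′ G
    opp = All.map adj⇒opposite present
    small′ = subst Small (order-connected G connected) small

  E-ends : ∀ k xs → xs ∈ paths n k →
    E (ends xs) ℚ.≤ ι k ℚ.* (ι k ℚ.* (p ^ℚ ℕ.suc k ℚ.* θ ^ℚ k))
  E-ends k xs xs∈ with paths-length n k xs∈
  ... | refl = begin
    E (ends xs)
      ≡⟨ μ-sum (λ z₁ G → sum (λ z₂ → indicator xs z₁ z₂ G) xs) xs ⟩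
    sum (λ z₁ → E (λ G → sum (λ z₂ → indicator xs z₁ z₂ G) xs)) xs
      ≡⟨ sum-cong (λ z₁ → μ-sum (indicator xs z₁) xs) xs ⟩
    sum (λ z₁ → sum (λ z₂ → E (indicator xs z₁ z₂)) xs) xs
      ≤⟨ sum-bounded _ xs (λ z₁ z₁∈ → sum-bounded _ xs (λ z₂ → indicator-bound xs z₁ z₂ z₁∈)) ⟩
    ι k ℚ.* (ι k ℚ.* (p ^ℚ ℕ.suc k ℚ.* θ ^ℚ k)) ∎
    where open ℚ.≤-Reasoning

  ρ : ℚ
  ρ = ι n ℚ.* p ℚ.* θ

  E-count : E count ℚ.≤ ι 2 ℚ.* p ℚ.* sum (λ k → ι k ℚ.* ι k ℚ.* ρ ^ℚ k) sizes
  E-count = begin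
    E count
      ≡⟨ μ-sum (λ k G → sum (λ xs → ends xs G) (paths n k)) sizes ⟩
    sum (λ k → E (λ G → sum (λ xs → ends xs G) (paths n k))) sizes
      ≤⟨ sum-mono sizes (λ k _ → bound k) ⟩
    sum (λ k → ι 2 ℚ.* p ℚ.* (ι k ℚ.* ι k ℚ.* ρ ^ℚ k)) sizes
      ≡⟨ sum-* (ι 2 ℚ.* p) _ sizes ⟩
    ι 2 ℚ.* p ℚ.* sum (λ k → ι k ℚ.* ι k ℚ.* ρ ^ℚ k) sizes ∎
    where
    open ℚ.≤-Reasoning
    bound : ∀ k → E (λ G → sum (λ xs → ends xs G) (paths n k)) ℚ.≤ ι 2 ℚ.* p ℚ.* (ι k ℚ.* ι k ℚ.* ρ ^ℚ k)
    bound k = begin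
      E (λ G → sum (λ xs → ends xs G) (paths n k))
        ≡⟨ μ-sum ends (paths n k) ⟩
      sum (λ xs → E (ends xs)) (paths n k)
        ≤⟨ sum-bounded _ (paths n k) (E-ends k) ⟩
      ι (length (paths n k)) ℚ.* (ι k ℚ.* (ι k ℚ.* (p ^ℚ ℕ.suc k ℚ.* θ ^ℚ k)))
        ≡⟨ cong (ℚ._* (ι k ℚ.* (ι k ℚ.* (p ^ℚ ℕ.suc k ℚ.* θ ^ℚ k)))) (ι-length-paths n k) ⟩
      ι 2 ℚ.* ι n ^ℚ k ℚ.* (ι k ℚ.* (ι k ℚ.* (p ^ℚ ℕ.suc k ℚ.* θ ^ℚ k)))
        ≡⟨ solve 5 (λ N k p P T → con (ι 2) :* N :* (k :* (k :* (p :* P :* T))) :=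
             con (ι 2) :* p :* (k :* k :* (N :* P :* T))) refl (ι n ^ℚ k) (ι k) p (p ^ℚ k) (θ ^ℚ k) ⟩
      ι 2 ℚ.* p ℚ.* (ι k ℚ.* ι k ℚ.* (ι n ^ℚ k ℚ.* p ^ℚ k ℚ.* θ ^ℚ k))
        ≡⟨ cong (λ q → ι 2 ℚ.* p ℚ.* (ι k ℚ.* ι k ℚ.* q))
             (sym (trans (^-distrib-* (ι n ℚ.* p) θ k) (cong (ℚ._* θ ^ℚ k) (^-distrib-* (ι n) p k)))) ⟩
      ι 2 ℚ.* p ℚ.* (ι k ℚ.* ι k ℚ.* ρ ^ℚ k) ∎

  module _ {A : BipGraph n → Set} (A? : Decidable A)
           (complex : ∀ G → ¬ A G → ∃ λ v → Small (order G v) × ComplexComponent G v) where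

    failure : ℚ
    failure = 1ℚ ℚ.- E (λ G → 𝟙 (A? G))

    0≤failure : 0ℚ ℚ.≤ failure
    0≤failure = 0≤-difference (subst (E (λ G → 𝟙 (A? G)) ℚ.≤_) (unit 1ℚ) (mono λ G → 𝟙≤1 (A? G)))

    -- Markov's inequality: pointwise, either A holds or some shape is counted, so the two terms add
    -- up to at least 1.
    failure≤count : failure ℚ.≤ E count
    failure≤count = begin
      1ℚ ℚ.- e                        ≤⟨ ℚ.+-monoˡ-≤ (ℚ.- e) 1≤e+count ⟩
      e ℚ.+ E count ℚ.- e             ≡⟨ solve 2 (λ e c → e :+ c :- e := c) refl e (E count) ⟩
      E count                         ∎
      where
      open ℚ.≤-Reasoning
      e = E (λ G → 𝟙 (A? G))
      1≤ : ∀ G → 1ℚ ℚ.≤ 𝟙 (A? G) ℚ.+ count G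
      1≤ G with A? G
      ... | yes _  = ℚ.+-mono-≤ (ℚ.≤-refl {1ℚ}) (0≤count G)
      ... | no ¬a = let v , small , cc = complex G ¬a in
        ℚ.+-mono-≤ (ℚ.≤-refl {0ℚ}) (1≤count G v small cc)
      1≤e+count : 1ℚ ℚ.≤ e ℚ.+ E count
      1≤e+count = subst₂ ℚ._≤_ (unit 1ℚ) (μ-+ (λ G → 𝟙 (A? G)) count) (mono 1≤)

    -- Here a stands for |ε|. The constant is 2 · 4³ · 2 · 2: two starting classes for a path, the
    -- cube of a ≤ 4 (1 - ρ), the bound on (1 - ρ)³ Σ k² ρᵏ, and n p ≤ 2. The surplus factor p, from
    -- one edge more than vertices, is what cancels n.
    failure-bound : ∀ {a} → ρ ℚ.≤ 1ℚ → ι n ℚ.* p ℚ.≤ ι 2 → 0ℚ ℚ.≤ a → a ℚ.≤ ι 4 ℚ.* (1ℚ ℚ.- ρ) →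
      failure ℚ.* (a ^ℚ 3 ℚ.* ι n) ℚ.≤ ι 512
    failure-bound {a} ρ≤1 np≤2 0≤a a≤ = begin
      failure ℚ.* (a ^ℚ 3 ℚ.* ι n)
        ≤⟨ *-mono-≤ 0≤failure (0≤* (0≤^ 3 (0≤* (0≤ι 4) 0≤q)) (0≤ι n)) (ℚ.≤-trans failure≤count E-count)
             (*-monoˡ-≤ (ι n) (0≤ι n) (^-mono-≤ 0≤a a≤ 3)) ⟩
      ι 2 ℚ.* p ℚ.* S ℚ.* ((ι 4 ℚ.* q) ^ℚ 3 ℚ.* ι n)
        ≡⟨ solve 4 (λ p S q N → let b = con (ι 4) :* q in
             con (ι 2) :* p :* S :* (b :* (b :* (b :* con 1ℚ)) :* N) :=
             con (ι 128) :* ((q :* (q :* (q :* con 1ℚ)) :* S) :* (N :* p))) refl p S q (ι n) ⟩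
      ι 128 ℚ.* ((q ^ℚ 3 ℚ.* S) ℚ.* (ι n ℚ.* p))
        ≤⟨ *-monoʳ-≤ (ι 128) (0≤ι 128) (*-mono-≤ (0≤* (0≤^ 3 0≤q) 0≤S) (0≤ι 2)
             (sum-k²ρᵏ 0≤ρ ρ≤1 (ℕ.suc (n ℕ.+ n))) np≤2) ⟩
      ι 128 ℚ.* (ι 2 ℚ.* ι 2)         ≡⟨⟩
      ι 512                           ∎
      where
      open ℚ.≤-Reasoning
      q = 1ℚ ℚ.- ρ
      0≤q = 0≤-difference ρ≤1
      0≤ρ = 0≤* (0≤* (0≤ι n) 0≤p) 0≤θ
      S = sum (λ k → ι k ℚ.* ι k ℚ.* ρ ^ℚ k) sizes
      0≤S : 0ℚ ℚ.≤ S
      0≤S = sum-nonNeg (λ k → 0≤* (0≤* (0≤ι k) (0≤ι k)) (0≤^ k 0≤ρ)) sizes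

-- Both regimes at a rational value of ε

search : ∀ {n} {P : Vertex n → Set} → Decidable P → ¬ (∀ v → ¬ P v) → ∃ P
search {n} P? ¬∀¬ with Any.any? P? (vertices n)
... | yes any  = let v , _ , Pv = find any in v , Pv
... | no ¬any = contradiction (λ v Pv → ¬any (lose (∈-vertices v) Pv)) ¬∀¬

1^k≤1 : ∀ k → 1ℚ ^ℚ k ℚ.≤ 1ℚ
1^k≤1 ℕ.zero    = ℚ.≤-refl
1^k≤1 (ℕ.suc k) = subst (ℚ._≤ 1ℚ) (sym (ℚ.*-identityˡ (1ℚ ^ℚ k))) (1^k≤1 k)

module Rational (n : ℕ) .{{_ : NonZero n}} (2≤n : 2 ℕ.≤ n) (e : ℚ) where

  p : ℚ
  p = (1ℚ ℚ.+ e) ℚ.* (+ 1 ℚ./ n)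

  np≡ : ι n ℚ.* p ≡ 1ℚ ℚ.+ e
  np≡ = begin
    ι n ℚ.* ((1ℚ ℚ.+ e) ℚ.* (+ 1 ℚ./ n))
      ≡⟨ solve 3 (λ N q i → N :* (q :* i) := q :* (N :* i)) refl (ι n) (1ℚ ℚ.+ e) (+ 1 ℚ./ n) ⟩
    (1ℚ ℚ.+ e) ℚ.* (ι n ℚ.* (+ 1 ℚ./ n))   ≡⟨ cong ((1ℚ ℚ.+ e) ℚ.*_) (ι*1/ n) ⟩
    (1ℚ ℚ.+ e) ℚ.* 1ℚ                      ≡⟨ ℚ.*-identityʳ (1ℚ ℚ.+ e) ⟩
    1ℚ ℚ.+ e                               ∎
    where open ≡-Reasoning

  module _ (0≤1+e : 0ℚ ℚ.≤ 1ℚ ℚ.+ e) (e≤1 : e ℚ.≤ 1ℚ) where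

    0≤p : 0ℚ ℚ.≤ p
    0≤p = 0≤* 0≤1+e (ℚ.nonNegative⁻¹ (+ 1 ℚ./ n) {{ℚ.normalize-nonNeg 1 n}})

    np≤2 : ι n ℚ.* p ℚ.≤ ι 2
    np≤2 = subst (ℚ._≤ ι 2) (sym np≡) (ℚ.+-monoʳ-≤ 1ℚ e≤1)

    -- From 2 p ≤ n p ≤ 2. For n = 1 and e > 0 the value 1 + e would not be a probability.
    p≤1 : p ℚ.≤ 1ℚ
    p≤1 = ℚ.*-cancelˡ-≤-pos (ι 2) (ℚ.≤-trans (*-monoˡ-≤ p 0≤p (ι-mono 2≤n)) np≤2)

  private
    Failure : {A : BipGraph n → Set} → Decidable A → ℚ
    Failure A? = 1ℚ ℚ.- Gnp n p (λ G → 𝟙 (A? G))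

  module _ (e≤0 : e ℚ.≤ 0ℚ) (-e≤1 : ℚ.- e ℚ.≤ 1ℚ) where

    0≤1+e : 0ℚ ℚ.≤ 1ℚ ℚ.+ e
    0≤1+e = subst (0ℚ ℚ.≤_) (solve 1 (λ e → con 1ℚ :- (:- e) := con 1ℚ :+ e) refl e) (0≤-difference -e≤1)

    e≤1 : e ℚ.≤ 1ℚ
    e≤1 = ℚ.≤-trans e≤0 (ℚ.nonNegative⁻¹ 1ℚ)

    subcritical-bound : 0ℚ ℚ.≤ Failure (noComplexComponent? {n}) ×
      Failure (noComplexComponent? {n}) ℚ.* ((ℚ.- e) ^ℚ 3 ℚ.* ι n) ℚ.≤ ι 512
    subcritical-bound = 0≤failure noComplexComponent? complex
      , failure-bound noComplexComponent? complex
          (subst (ℚ._≤ 1ℚ) (sym ρ≡) (≤-from-difference (ℚ.- e) 0≤-e (solve 1 (λ e → con 1ℚ :+ e :+ (:- e) := con 1ℚ) refl e)))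
          (np≤2 0≤1+e e≤1) 0≤-e
          (subst (λ ρ → ℚ.- e ℚ.≤ ι 4 ℚ.* (1ℚ ℚ.- ρ)) (sym ρ≡)
            (≤-from-difference (ι 3 ℚ.* (ℚ.- e)) (0≤* (0≤ι 3) 0≤-e)
              (solve 1 (λ e → (:- e) :+ con (ι 3) :* (:- e) := con (ι 4) :* (con 1ℚ :- (con 1ℚ :+ e))) refl e)))
      where
      0≤-e : 0ℚ ℚ.≤ ℚ.- e
      0≤-e = ℚ.neg-antimono-≤ e≤0
      drift : ∀ r s → ⊤ → n ℕ.≤ r ℕ.+ s → ((1ℚ ℚ.- p) ℚ.+ p ℚ.* 1ℚ) ^ℚ r ℚ.≤ 1ℚ
      drift r _ _ _ = subst (λ d → d ^ℚ r ℚ.≤ 1ℚ)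
        (solve 1 (λ p → con 1ℚ := (con 1ℚ :- p) :+ p :* con 1ℚ) refl p) (1^k≤1 r)
      open FirstMoment {n} (0≤p 0≤1+e e≤1) (p≤1 0≤1+e e≤1) {λ _ → ⊤} (λ _ → yes tt) (λ _ _ → tt)
        {1ℚ} (ℚ.nonNegative⁻¹ 1ℚ) drift
      complex : ∀ G → ¬ NoComplexComponent G → ∃ λ v → ⊤ × ComplexComponent G v
      complex G ¬none = let v , cc = search (complexComponent? G) ¬none in v , tt , cc
      ρ≡ : ρ ≡ 1ℚ ℚ.+ e
      ρ≡ = trans (ℚ.*-identityʳ (ι n ℚ.* p)) np≡

  module _ (0≤e : 0ℚ ℚ.≤ e) (e≤1% : ι 100 ℚ.* e ℚ.≤ 1ℚ) (large : ι 1000 ℚ.≤ e ^ℚ 3 ℚ.* ι n) where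

    private
      t = e ℚ.* (+ 1 ℚ./ 4)
      4t≡e : ι 4 ℚ.* t ≡ e
      4t≡e = solve 1 (λ e → con (ι 4) :* (e :* con (+ 1 ℚ./ 4)) := e) refl e
      0≤t : 0ℚ ℚ.≤ t
      0≤t = 0≤* 0≤e (ℚ.nonNegative⁻¹ (+ 1 ℚ./ 4))
      400t≤1 : ι 400 ℚ.* t ℚ.≤ 1ℚ
      400t≤1 = subst (ℚ._≤ 1ℚ)
        (solve 1 (λ e → con (ι 100) :* e := con (ι 400) :* (e :* con (+ 1 ℚ./ 4))) refl e) e≤1%
      multiple≤1 : ∀ k → k ℕ.≤ 400 → ι k ℚ.* t ℚ.≤ 1ℚ
      multiple≤1 k k≤ = ℚ.≤-trans (*-monoˡ-≤ t 0≤t (ι-mono k≤)) 400t≤1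
      0≤1+e′ : 0ℚ ℚ.≤ 1ℚ ℚ.+ e
      0≤1+e′ = 0≤+ (ℚ.nonNegative⁻¹ 1ℚ) 0≤e
      e≤1′ : e ℚ.≤ 1ℚ
      e≤1′ = subst (ℚ._≤ 1ℚ) 4t≡e (multiple≤1 4 (ℕ.m≤m+n 4 396))

    -- Here ρ = (1 + 4 t) (1 - 5 t) = 1 - t - 20 t², so that 4 (1 - ρ) = e + 80 t²; both slacks are
    -- explicit.
    supercritical-bound : 0ℚ ℚ.≤ Failure (noSmallComplexComponent? {n}) ×
      Failure (noSmallComplexComponent? {n}) ℚ.* (e ^ℚ 3 ℚ.* ι n) ℚ.≤ ι 512
    supercritical-bound = 0≤failure noSmallComplexComponent? complex
      , failure-bound noSmallComplexComponent? complex
          (≤-from-difference (t ℚ.+ ι 20 ℚ.* (t ℚ.* t)) (0≤+ 0≤t (0≤* (0≤ι 20) (0≤* 0≤t 0≤t)))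
            (trans (cong (ℚ._+ (t ℚ.+ ι 20 ℚ.* (t ℚ.* t))) ρ≡)
              (solve 1 (λ t → (con 1ℚ :+ con (ι 4) :* t) :* (con 1ℚ :- con (ι 5) :* t)
                 :+ (t :+ con (ι 20) :* (t :* t)) := con 1ℚ) refl t)))
          (np≤2 0≤1+e′ e≤1′) 0≤e
          (≤-from-difference (ι 80 ℚ.* (t ℚ.* t)) (0≤* (0≤ι 80) (0≤* 0≤t 0≤t))
            (trans (cong (ℚ._+ ι 80 ℚ.* (t ℚ.* t)) (sym 4t≡e))
              (trans (solve 1 (λ t → con (ι 4) :* t :+ con (ι 80) :* (t :* t) :=
                       con (ι 4) :* (con 1ℚ :- (con 1ℚ :+ con (ι 4) :* t) :* (con 1ℚ :- con (ι 5) :* t))) refl t)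
                (cong (λ q → ι 4 ℚ.* (1ℚ ℚ.- q)) (sym ρ≡)))))
      where
      θ = 1ℚ ℚ.- ι 5 ℚ.* t
      Small : ℕ → Set
      Small s = s ℕ.^ 3 ℕ.≤ n ℕ.^ 2
      drift : ∀ r s → Small s → n ℕ.≤ r ℕ.+ s → ((1ℚ ℚ.- p) ℚ.+ p ℚ.* θ) ^ℚ r ℚ.≤ θ
      drift r s small n≤r+s = Survival.survival-drift {t} {p} {ι n} 0≤t 400t≤1
        (trans (ℚ.*-comm p (ι n)) (trans np≡ (cong (1ℚ ℚ.+_) (sym 4t≡e))))
        (0≤p 0≤1+e′ e≤1′) (p≤1 0≤1+e′ e≤1′) (0≤ι n)
        (subst (λ e → ι 1000 ℚ.≤ e ^ℚ 3 ℚ.* ι n) (sym 4t≡e) large)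
        r (0≤ι s) (subst₂ ℚ._≤_ (ι-^ s 3) (ι-^ n 2) (ι-mono small))
        (subst (ι n ℚ.≤_) (ι-+ r s) (ι-mono n≤r+s))
      open FirstMoment {n} (0≤p 0≤1+e′ e≤1′) (p≤1 0≤1+e′ e≤1′) {Small} (λ s → s ℕ.^ 3 ℕ.≤? n ℕ.^ 2)
        (λ s≤t t³≤ → ℕ.≤-trans (ℕ.^-monoˡ-≤ 3 s≤t) t³≤)
        {θ} (0≤-difference (multiple≤1 5 (ℕ.m≤m+n 5 395))) drift
      complex : ∀ G → ¬ NoSmallComplexComponent G → ∃ λ v → Small (order G v) × ComplexComponent G v
      complex G ¬none = search (λ v → (order G v ℕ.^ 3 ℕ.≤? n ℕ.^ 2) ×-dec complexComponent? G v)
        λ none → ¬none λ v small cc → none v (small , cc)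
      ρ≡ : ρ ≡ (1ℚ ℚ.+ ι 4 ℚ.* t) ℚ.* (1ℚ ℚ.- ι 5 ℚ.* t)
      ρ≡ = cong (ℚ._* θ) (trans np≡ (cong (1ℚ ℚ.+_) (sym 4t≡e)))

-- From rationals to reals

+-nonPos⇒nonPos : ∀ {a b} → a ℚ.+ b ℚ.≤ 0ℚ → 0ℚ ℚ.< b → a ℚ.≤ 0ℚ
+-nonPos⇒nonPos {a} {b} a+b≤0 0<b = ℚ.≤-trans (≤-from-difference b (ℚ.<⇒≤ 0<b) refl) a+b≤0

∣nonPos∣ : ∀ {a} → a ℚ.≤ 0ℚ → ℚ.∣ a ∣ ≡ ℚ.- a
∣nonPos∣ {a} a≤0 = trans (sym (ℚ.∣-p∣≡∣p∣ a)) (ℚ.0≤p⇒∣p∣≡p (ℚ.neg-antimono-≤ a≤0))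

bounded-by-512 : ∀ n {P Q a} tol → Q ≡ P → 0ℚ ℚ.≤ 1ℚ ℚ.- P → (1ℚ ℚ.- P) ℚ.* (a ^ℚ 3 ℚ.* ι n) ℚ.≤ ι 512 →
  0ℚ ℚ.< tol → ℚ.∣ 1ℚ ℚ.- Q ∣ ℚ.* (a ^ℚ 3 ℚ.* (+ n ℚ./ 1)) ℚ.≤ ι 512 ℚ.+ tol
bounded-by-512 n {P} {a = a} tol refl 0≤ bound 0<tol = ℚ.≤-trans
  (ℚ.≤-reflexive (cong₂ (λ F N → F ℚ.* (a ^ℚ 3 ℚ.* N)) (ℚ.0≤p⇒∣p∣≡p 0≤) (/1≡ι n)))
  (ℚ.≤-trans bound (≤-from-difference tol (ℚ.<⇒≤ 0<tol) refl))

module _ (ε : Sequence) (large : (λ n → ∣ ε n ∣ ^ 3 * fromℕ n) ⟶∞) (small : ε =o[1]) where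

  -- What is known of the real `ε n` passes only to its late approximations, and how late depends on
  -- n, hence the order of the quantifiers.
  approximation : ∃ λ N → ∀ n .{{_ : NonZero n}} → N ℕ.≤ n → 2 ℕ.≤ n × ∃ λ M → ∀ m → M ℕ.≤ m →
    ι 100 ℚ.* ℚ.∣ approx (ε n) m ∣ ℚ.≤ 1ℚ × ι 1000 ℚ.≤ ℚ.∣ approx (ε n) m ∣ ^ℚ 3 ℚ.* ι n
  approximation = 2 ℕ.⊔ (N₁ ℕ.⊔ N₂) , λ n N≤n →
    let N₁⊔N₂≤n = ℕ.m⊔n≤o⇒n≤o 2 (N₁ ℕ.⊔ N₂) N≤n
        M₁ , close₁ = large₁ n (ℕ.m⊔n≤o⇒m≤o N₁ N₂ N₁⊔N₂≤n) 1ℚ (ℚ.positive⁻¹ 1ℚ)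
        M₂ , close₂ = small₂ n (ℕ.m⊔n≤o⇒n≤o N₁ N₂ N₁⊔N₂≤n) δ (ℚ.positive⁻¹ δ)
    in ℕ.m⊔n≤o⇒m≤o 2 (N₁ ℕ.⊔ N₂) N≤n , M₁ ℕ.⊔ M₂ , λ m M≤m →
         *-monoʳ-≤ (ι 100) (0≤ι 100) (close₂ m (ℕ.m⊔n≤o⇒n≤o M₁ M₂ M≤m))
       , subst (λ x → ι 1000 ℚ.≤ ℚ.∣ approx (ε n) m ∣ ^ℚ 3 ℚ.* x) (/1≡ι n)
           (cancel 1000 (close₁ m (ℕ.m⊔n≤o⇒m≤o M₁ M₂ M≤m)))
    where
    δ : ℚ
    -- Half of 1/100: the order on ℝ adds a tolerance, which is again taken to be δ.
    δ = + 1 ℚ./ 200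
    -- One more than 1000 is asked for, since the tolerance taken here is 1; `cancel` removes it.
    N₁ = proj₁ (large (fromℚ (ι (ℕ.suc 1000))))
    large₁ = proj₂ (large (fromℚ (ι (ℕ.suc 1000))))
    0<δ : 0ᴿ < fromℚ δ
    0<δ = δ , ℚ.positive⁻¹ δ , 0 , λ _ _ → ℚ.≤-reflexive (ℚ.+-identityˡ δ)
    N₂ = proj₁ (small (fromℚ δ) 0<δ)
    small₂ = proj₂ (small (fromℚ δ) 0<δ)
    cancel : ∀ k {h} → ι (ℕ.suc k) ℚ.≤ h ℚ.+ 1ℚ → ι k ℚ.≤ h
    cancel k {h} le = subst₂ ℚ._≤_
      (solve 1 (λ x → con 1ℚ :+ x :- con 1ℚ := x) refl (ι k))
      (solve 1 (λ x → x :+ con 1ℚ :- con 1ℚ := x) refl h)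
      (ℚ.+-monoˡ-≤ (ℚ.- 1ℚ) le)

  N₀ : ℕ
  N₀ = proj₁ approximation

  subcritical : (∀ n .{{_ : NonZero n}} → ε n < 0ᴿ) →
    (λ n → 1ᴿ - Pr n (edgeProbability ε n) NoComplexComponent noComplexComponent?)
      =O[1/ (λ n → ∣ ε n ∣ ^ 3 * fromℕ n) ]
  subcritical ε<0 = fromℚ (ι 512) , N₀ , bound
    where
    bound : ∀ n .{{_ : NonZero n}} → N₀ ℕ.≤ n →
      ∣ 1ᴿ - Pr n (edgeProbability ε n) NoComplexComponent noComplexComponent? ∣
        * (∣ ε n ∣ ^ 3 * fromℕ n) ≤ fromℚ (ι 512)
    bound n N≤n tol 0<tol =
      let 2≤n , M₁ , close = proj₂ approximation n N≤n
          d , 0<d , M₂ , negative = ε<0 n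
      in M₁ ℕ.⊔ M₂ , λ m M≤m → at 2≤n m
           (proj₁ (close m (ℕ.m⊔n≤o⇒m≤o M₁ M₂ M≤m)))
           (+-nonPos⇒nonPos (negative m (ℕ.m⊔n≤o⇒n≤o M₁ M₂ M≤m)) 0<d)
      where
      at : 2 ℕ.≤ n → ∀ m → ι 100 ℚ.* ℚ.∣ approx (ε n) m ∣ ℚ.≤ 1ℚ → approx (ε n) m ℚ.≤ 0ℚ →
        ℚ.∣ 1ℚ ℚ.- approx (Pr n (edgeProbability ε n) NoComplexComponent noComplexComponent?) m ∣
          ℚ.* (ℚ.∣ approx (ε n) m ∣ ^ℚ 3 ℚ.* (+ n ℚ./ 1)) ℚ.≤ ι 512 ℚ.+ tol
      at 2≤n m e≤1% e≤0 = bounded-by-512 n {a = ℚ.∣ e ∣} tol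
        (approx-Pr m n (edgeProbability ε n) NoComplexComponent noComplexComponent?
          (0≤p (0≤1+e e≤0 -e≤1) (e≤1 e≤0 -e≤1)) (p≤1 (0≤1+e e≤0 -e≤1) (e≤1 e≤0 -e≤1)))
        (proj₁ result)
        (subst (λ a → (1ℚ ℚ.- Gnp n p (λ G → 𝟙 (noComplexComponent? G))) ℚ.* (a ^ℚ 3 ℚ.* ι n) ℚ.≤ ι 512)
          (sym (∣nonPos∣ e≤0)) (proj₂ result))
        0<tol
        where
        e = approx (ε n) m
        open Rational n 2≤n e
        -e≤1 : ℚ.- e ℚ.≤ 1ℚ
        -e≤1 = begin
          ℚ.- e              ≡⟨ ∣nonPos∣ e≤0 ⟨
          ℚ.∣ e ∣            ≡⟨ ℚ.*-identityˡ ℚ.∣ e ∣ ⟨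
          ι 1 ℚ.* ℚ.∣ e ∣    ≤⟨ *-monoˡ-≤ ℚ.∣ e ∣ (ℚ.0≤∣p∣ e) (ι-mono {1} {100} (s≤s ℕ.z≤n)) ⟩
          ι 100 ℚ.* ℚ.∣ e ∣  ≤⟨ e≤1% ⟩
          1ℚ                 ∎
          where open ℚ.≤-Reasoning
        result = subcritical-bound e≤0 -e≤1

  supercritical : (∀ n .{{_ : NonZero n}} → 0ᴿ < ε n) →
    (λ n → 1ᴿ - Pr n (edgeProbability ε n) NoSmallComplexComponent noSmallComplexComponent?)
      =O[1/ (λ n → ε n ^ 3 * fromℕ n) ]
  supercritical 0<ε = fromℚ (ι 512) , N₀ , bound
    where
    bound : ∀ n .{{_ : NonZero n}} → N₀ ℕ.≤ n →
      ∣ 1ᴿ - Pr n (edgeProbability ε n) NoSmallComplexComponent noSmallComplexComponent? ∣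
        * (ε n ^ 3 * fromℕ n) ≤ fromℚ (ι 512)
    bound n N≤n tol 0<tol =
      let 2≤n , M₁ , close = proj₂ approximation n N≤n
          d , 0<d , M₂ , positive = 0<ε n
      in M₁ ℕ.⊔ M₂ , λ m M≤m → at 2≤n m
           (close m (ℕ.m⊔n≤o⇒m≤o M₁ M₂ M≤m))
           (ℚ.≤-trans (ℚ.≤-trans (ℚ.<⇒≤ 0<d) (ℚ.≤-reflexive (sym (ℚ.+-identityˡ d))))
                      (positive m (ℕ.m⊔n≤o⇒n≤o M₁ M₂ M≤m)))
      where
      at : 2 ℕ.≤ n → ∀ m → ι 100 ℚ.* ℚ.∣ approx (ε n) m ∣ ℚ.≤ 1ℚ × ι 1000 ℚ.≤ ℚ.∣ approx (ε n) m ∣ ^ℚ 3 ℚ.* ι n →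
        0ℚ ℚ.≤ approx (ε n) m →
        ℚ.∣ 1ℚ ℚ.- approx (Pr n (edgeProbability ε n) NoSmallComplexComponent noSmallComplexComponent?) m ∣
          ℚ.* (approx (ε n) m ^ℚ 3 ℚ.* (+ n ℚ./ 1)) ℚ.≤ ι 512 ℚ.+ tol
      at 2≤n m (∣e∣≤1% , large∣e∣) 0≤e = bounded-by-512 n {a = e} tol
        (approx-Pr m n (edgeProbability ε n) NoSmallComplexComponent noSmallComplexComponent?
          (0≤p 0≤1+e′ e≤1′) (p≤1 0≤1+e′ e≤1′))
        (proj₁ result) (proj₂ result) 0<tol
        where
        e = approx (ε n) m
        ∣e∣≡e = ℚ.0≤p⇒∣p∣≡p 0≤e
        e≤1% : ι 100 ℚ.* e ℚ.≤ 1ℚ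
        e≤1% = subst (λ a → ι 100 ℚ.* a ℚ.≤ 1ℚ) ∣e∣≡e ∣e∣≤1%
        open Rational n 2≤n e
        0≤1+e′ : 0ℚ ℚ.≤ 1ℚ ℚ.+ e
        0≤1+e′ = 0≤+ (ℚ.nonNegative⁻¹ 1ℚ) 0≤e
        e≤1′ : e ℚ.≤ 1ℚ
        e≤1′ = begin
          e              ≡⟨ ℚ.*-identityˡ e ⟨
          ι 1 ℚ.* e      ≤⟨ *-monoˡ-≤ e 0≤e (ι-mono {1} {100} (s≤s ℕ.z≤n)) ⟩
          ι 100 ℚ.* e    ≤⟨ e≤1% ⟩
          1ℚ             ∎
          where open ℚ.≤-Reasoning
        result = supercritical-bound 0≤e e≤1% (subst (λ a → ι 1000 ℚ.≤ a ^ℚ 3 ℚ.* ι n) ∣e∣≡e large∣e∣)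

theorem1p9 : (ε : Sequence) →
    ((λ n → ∣ ε n ∣ ^ 3 * fromℕ n) ⟶∞) →
    (ε =o[1]) →
    ((∀ n .{{_ : NonZero n}} → ε n < 0ᴿ) →
    (λ n → 1ᴿ - Pr n (edgeProbability ε n) NoComplexComponent noComplexComponent?)
    =O[1/ (λ n → ∣ ε n ∣ ^ 3 * fromℕ n) ])
    ×
    ((∀ n .{{_ : NonZero n}} → 0ᴿ < ε n) →
    (λ n → 1ᴿ - Pr n (edgeProbability ε n) NoSmallComplexComponent noSmallComplexComponent?)
    =O[1/ (λ n → ε n ^ 3 * fromℕ n) ])
theorem1p9 ε large small = subcritical ε large small , supercritical ε large small
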